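{- Let $x_1,x_2,\tilde y_1,y_2,u_1,u_2,\tilde v_1,v_2,w_{\rm e},w_{\rm o},z_{\rm e},z_{\rm o}$ be commuting indeterminates and for $n\ge0$ let \[ \widetilde{P}'_n=\sum_{\sigma\in\mathfrak{D}_{2n}}x_1^{\mathrm{ereccpeak}'}x_2^{\mathrm{eareccdfall}'}\tilde y_1^{\mathrm{minval}}y_2^{\mathrm{ereccdrise}'}u_1^{\mathrm{nrcpeak}'}u_2^{\mathrm{nrcdfall}'}\tilde v_1^{\mathrm{nminval}}v_2^{\mathrm{nrcdrise}'}w_{\rm e}^{\mathrm{evennrfix}}w_{\rm o}^{\mathrm{oddnrfix}}z_{\rm e}^{\mathrm{evenrar}}z_{\rm o}^{\mathrm{oddrar}}, \] \[ \widetilde{P}_n=\sum_{\sigma\in\mathfrak{D}_{2n}}x_1^{\mathrm{eareccpeak}}x_2^{\mathrm{eareccdfall}}\tilde y_1^{\mathrm{minval}}y_2^{\mathrm{ereccdrise}}u_1^{\mathrm{nrcpeak}}u_2^{\mathrm{nrcdfall}}\tilde v_1^{\mathrm{nminval}}v_2^{\mathrm{nrcdrise}}w_{\rm e}^{\mathrm{evennrfix}}w_{\rm o}^{\mathrm{oddnrfix}}z_{\rm e}^{\mathrm{evenrar}}z_{\rm o}^{\mathrm{oddrar}}. \] Then $\sum_{n\ge0}\widetilde{P}'_nt^n$ equals the T-fraction $\cfrac{1}{1-\delta_1t-\cfrac{\alpha_1t}{1-\delta_2t-\cfrac{\alpha_2t}{1-\cdots}}}$ with, for $k\ge1$, $\alpha_{2k-1}=[x_1+(k-1)u_1][\tilde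 y_1+(k-1)\tilde v_1]$, $\alpha_{2k}=[x_2+(k-1)u_2+w_{\rm e}][y_2+(k-1)v_2+w_{\rm o}]$, $\delta_1=z_{\rm e}z_{\rm o}$, $\delta_n=0$ for $n\ge2$ (the same T-fraction as for $\widetilde{P}_n$); therefore $\widetilde{P}'_n=\widetilde{P}_n$ for all $n\ge0$.
   Context: A D-permutation of $[2n]$: $\sigma(2k-1)\ge2k-1$ and $\sigma(2k)\le2k$ for all $k$; $\mathfrak{D}_{2n}$ is their set. Cycle peak: $\sigma^{ -1}(i)<i>\sigma(i)$; cycle valley: $\sigma^{ -1}(i)>i<\sigma(i)$; cycle double rise: $\sigma^{ -1}(i)<i<\sigma(i)$; cycle double fall: $\sigma^{ -1}(i)>i>\sigma(i)$. Record: $\sigma(j)<\sigma(i)$ for all $j<i$; antirecord: $\sigma(j)>\sigma(i)$ for all $j>i$; exclusive record/antirecord = one but not the other; record-antirecord = both. Unprimed: $\mathrm{eareccpeak},\mathrm{eareccdfall}$ count cycle peaks, double falls $i$ that are exclusive antirecords; $\mathrm{ereccdrise}$ counts cycle double rises $i$ that are exclusive records; $\mathrm{nrcpeak},\mathrm{nrcdfall},\mathrm{nrcdrise}$ count cycle peaks, double falls, double rises $i$ that are neither records nor antirecords. Primed: $\mathrm{ereccpeak}'$ counts cycle peaks $i$ with $\sigma^{ -1}(i)$ an exclusive record; $\mathrm{eareccdfall}'$ counts cycle double falls $i$ with $\sigma^{ -1}(i)$ an exclusive antirecord; $\mathrm{ereccdrise}'$ counts cycle double rises $i$ with $\sigma^{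 -1}(i)$ an exclusive record; $\mathrm{nrcpeak}',\mathrm{nrcdfall}',\mathrm{nrcdrise}'$ count cycle peaks, double falls, double rises $i$ with $\sigma^{ -1}(i)$ neither a record nor an antirecord. $\mathrm{minval}$ counts cycle valleys that are the minimum of their cycle, $\mathrm{nminval}$ the other cycle valleys; $\mathrm{evennrfix}$/$\mathrm{oddnrfix}$ count even/odd fixed points that are neither records nor antirecords; $\mathrm{evenrar}$/$\mathrm{oddrar}$ count even/odd record-antirecords. -}

module Defs where

open import Data.Nat using (ℕ; zero; suc; _∸_; _<ᵇ_; _≤ᵇ_; _≡ᵇ_; _%_; _/_)
open import Data.Bool using (Bool; true; false; _∧_; _∨_; not; if_then_else_)
open import Data.Fin using (Fin; toℕ)
open import Data.Vec using (Vec; []; _∷_; lookup)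
open import Data.List.Base using (List; []; _∷_; [_]; map; concatMap; allFin; filterᵇ)
open import Data.Nat.ListAction using (sum)
open import Algebra.Bundles using (CommutativeRing)
import Data.Nat
open import Data.Product using (∃-syntax)

-- Permutations of [m] = {1,…,m}.  A map [m] → [m] is represented by a
-- function Fin m → Fin m; element i : Fin m stands for the integer
-- toℕ i + 1 (comparisons via toℕ are the same as on 1-based values).

val : ∀ {m} → Fin m → ℕ
val i = suc (toℕ i)

allᵇ : ∀ {A : Set} → (A → Bool) → List A → Bool
allᵇ p [] = true
allᵇ p (a ∷ as) = p a ∧ allᵇ p as

_⇒ᵇ_ : Bool → Bool → Bool
a ⇒ᵇ b = not a ∨ b

isOddᵇ : ℕ → Bool
isOddᵇ k = k % 2 ≡ᵇ 1

isEvenᵇ : ℕ → Bool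
isEvenᵇ k = k % 2 ≡ᵇ 0

allVecs : ∀ {m} k → List (Vec (Fin m) k)
allVecs zero = [ [] ]
allVecs {m} (suc k) = concatMap (λ a → map (a ∷_) (allVecs k)) (allFin m)

-- σ is injective (hence a bijection of the finite set [m])
isPermᵇ : ∀ {m} → (Fin m → Fin m) → Bool
isPermᵇ {m} σ =
  allᵇ (λ i → allᵇ (λ j → (toℕ (σ i) ≡ᵇ toℕ (σ j)) ⇒ᵇ (toℕ i ≡ᵇ toℕ j)) (allFin m)) (allFin m)

isDᵇ : ∀ {m} → (Fin m → Fin m) → Bool
isDᵇ {m} σ = allᵇ (λ i → if isOddᵇ (val i)
                           then toℕ i ≤ᵇ toℕ (σ i)
                           else toℕ (σ i) ≤ᵇ toℕ i) (allFin m)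

DPerms : (n : ℕ) → List (Fin (2 Data.Nat.* n) → Fin (2 Data.Nat.* n))
DPerms n = filterᵇ (λ σ → isPermᵇ σ ∧ isDᵇ σ) (map (λ v i → lookup v i) (allVecs (2 Data.Nat.* n)))

module Stats {m : ℕ} (σ : Fin m → Fin m) where

  count : (Fin m → Bool) → ℕ
  count p = sum (map (λ i → if p i then 1 else 0) (allFin m))

  findFrom : List (Fin m) → Fin m → Fin m
  findFrom [] i = i
  findFrom (j ∷ js) i = if toℕ (σ j) ≡ᵇ toℕ i then j else findFrom js i

  σinv : Fin m → Fin m
  σinv i = findFrom (allFin m) i

  iter : ℕ → Fin m → Fin m
  iter zero i = i
  iter (suc k) i = σ (iter k i)

  cpeak cvalley cdrise cdfall fixed : Fin m → Bool
  cpeak i   = (toℕ (σinv i) <ᵇ toℕ i) ∧ (toℕ (σ i) <ᵇ toℕ i)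
  cvalley i = (toℕ i <ᵇ toℕ (σinv i)) ∧ (toℕ i <ᵇ toℕ (σ i))
  cdrise i  = (toℕ (σinv i) <ᵇ toℕ i) ∧ (toℕ i <ᵇ toℕ (σ i))
  cdfall i  = (toℕ i <ᵇ toℕ (σinv i)) ∧ (toℕ (σ i) <ᵇ toℕ i)
  fixed i   = toℕ (σ i) ≡ᵇ toℕ i

  record? antirecord? : Fin m → Bool
  record? i = allᵇ (λ j → (toℕ j <ᵇ toℕ i) ⇒ᵇ (toℕ (σ j) <ᵇ toℕ (σ i))) (allFin m)
  antirecord? i = allᵇ (λ j → (toℕ i <ᵇ toℕ j) ⇒ᵇ (toℕ (σ i) <ᵇ toℕ (σ j))) (allFin m)

  erec earec nrar rar : Fin m → Bool
  erec i  = record? i ∧ not (antirecord? i)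
  earec i = antirecord? i ∧ not (record? i)
  nrar i  = not (record? i) ∧ not (antirecord? i)
  rar i   = record? i ∧ antirecord? i

  -- i is the minimum of its cycle: σ^k(i) ≥ i for all k (k < m covers the orbit)
  cycmin : Fin m → Bool
  cycmin i = allᵇ (λ k → toℕ i ≤ᵇ toℕ (iter (toℕ k) i)) (allFin m)

  eareccpeak eareccdfall ereccdrise nrcpeak nrcdfall nrcdrise : ℕ
  eareccpeak  = count (λ i → cpeak i ∧ earec i)
  eareccdfall = count (λ i → cdfall i ∧ earec i)
  ereccdrise  = count (λ i → cdrise i ∧ erec i)
  nrcpeak     = count (λ i → cpeak i ∧ nrar i)
  nrcdfall    = count (λ i → cdfall i ∧ nrar i)
  nrcdrise    = count (λ i → cdrise i ∧ nrar i)

  ereccpeak′ eareccdfall′ ereccdrise′ nrcpeak′ nrcdfall′ nrcdrise′ : ℕ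
  ereccpeak′   = count (λ i → cpeak i ∧ erec (σinv i))
  eareccdfall′ = count (λ i → cdfall i ∧ earec (σinv i))
  ereccdrise′  = count (λ i → cdrise i ∧ erec (σinv i))
  nrcpeak′     = count (λ i → cpeak i ∧ nrar (σinv i))
  nrcdfall′    = count (λ i → cdfall i ∧ nrar (σinv i))
  nrcdrise′    = count (λ i → cdrise i ∧ nrar (σinv i))

  minval nminval evennrfix oddnrfix evenrar oddrar : ℕ
  minval    = count (λ i → cvalley i ∧ cycmin i)
  nminval   = count (λ i → cvalley i ∧ not (cycmin i))
  evennrfix = count (λ i → fixed i ∧ nrar i ∧ isEvenᵇ (val i))
  oddnrfix  = count (λ i → fixed i ∧ nrar i ∧ isOddᵇ (val i))
  evenrar   = count (λ i → rar i ∧ isEvenᵇ (val i))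
  oddrar    = count (λ i → rar i ∧ isOddᵇ (val i))

-- Polynomials in the 12 commuting indeterminates are handled by
-- evaluation in an arbitrary commutative ring R (an identity of
-- polynomials / power series over ℤ holds iff it holds for all
-- evaluations in all commutative rings).

module Poly {c ℓ} (R : CommutativeRing c ℓ)
  (x₁ x₂ ỹ₁ y₂ u₁ u₂ ṽ₁ v₂ wₑ wₒ zₑ zₒ : CommutativeRing.Carrier R) where

  open CommutativeRing R

  pow : Carrier → ℕ → Carrier
  pow a zero = 1#
  pow a (suc k) = a * pow a k

  nat· : ℕ → Carrier → Carrier
  nat· zero a = 0#
  nat· (suc k) a = a + nat· k a

  sumR : List Carrier → Carrier
  sumR [] = 0#
  sumR (a ∷ as) = a + sumR as

  weight′ : ∀ {m} → (Fin m → Fin m) → Carrier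
  weight′ σ = pow x₁ ereccpeak′ * pow x₂ eareccdfall′ * pow ỹ₁ minval * pow y₂ ereccdrise′
            * pow u₁ nrcpeak′ * pow u₂ nrcdfall′ * pow ṽ₁ nminval * pow v₂ nrcdrise′
            * pow wₑ evennrfix * pow wₒ oddnrfix * pow zₑ evenrar * pow zₒ oddrar
    where open Stats σ

  weight : ∀ {m} → (Fin m → Fin m) → Carrier
  weight σ = pow x₁ eareccpeak * pow x₂ eareccdfall * pow ỹ₁ minval * pow y₂ ereccdrise
           * pow u₁ nrcpeak * pow u₂ nrcdfall * pow ṽ₁ nminval * pow v₂ nrcdrise
           * pow wₑ evennrfix * pow wₒ oddnrfix * pow zₑ evenrar * pow zₒ oddrar
    where open Stats σ

  P′ : ℕ → Carrier
  P′ n = sumR (map weight′ (DPerms n))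

  P : ℕ → Carrier
  P n = sumR (map weight (DPerms n))

  -- Formal power series in t over R, as coefficient sequences.

  PS : Set c
  PS = ℕ → Carrier

  sumTo : ℕ → (ℕ → Carrier) → Carrier
  sumTo zero f = f 0
  sumTo (suc n) f = sumTo n f + f (suc n)

  oneS : PS
  oneS zero = 1#
  oneS (suc n) = 0#

  mulS : PS → PS → PS
  mulS f g n = sumTo n (λ i → f i * g (n ∸ i))

  powS : PS → ℕ → PS
  powS g zero = oneS
  powS g (suc k) = mulS g (powS g k)

  -- 1 / (1 - t g) = Σ_k t^k g^k  (formal geometric series)
  inv1-t· : PS → PS
  inv1-t· g n = sumTo n (λ k → powS g k (n ∸ k))

  -- T-fraction coefficients (indexed from 1; index 0 unused)
  α : ℕ → Carrier
  α zero = 0#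
  α (suc k) = if isEvenᵇ k
                then (x₁ + nat· (k / 2) u₁) * (ỹ₁ + nat· (k / 2) ṽ₁)          -- α_{2j+1}, j = k/2
                else (x₂ + nat· (k / 2) u₂ + wₑ) * (y₂ + nat· (k / 2) v₂ + wₒ)  -- α_{2j+2}, j = k/2

  δ : ℕ → Carrier
  δ (suc zero) = zₑ * zₒ
  δ _ = 0#

  -- N-th convergent of the tail starting at level k:
  --   conv 0 k = 1,
  --   conv (N+1) k = 1 / (1 - δ_k t - α_k t · conv N (k+1))
  conv : ℕ → ℕ → PS
  conv zero k = oneS
  conv (suc N) k = inv1-t· (λ n → (if n ≡ᵇ 0 then δ k else 0#) + α k * conv N (suc k) n)

  -- The T-fraction (as a formal power series, i.e. the coefficientwise
  -- limit of its convergents) has n-th coefficient a: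
  TFracCoeff : ℕ → Carrier → Set ℓ
  TFracCoeff n a = ∃[ N₀ ] (∀ N → N₀ Data.Nat.≤ N → conv N 1 n ≈ a)

{-# OPTIONS --safe #-}
module Submission where

-- Read a D-permutation σ of {0, ..., M - 1} from its largest element down.  At
-- threshold d the restriction of σ to {d, ..., M - 1} is a partial injection
-- with k open positions (image below d) and k open values (preimage below d).
-- The next element i is a fixed point, a peak or a double fall if its 1-based
-- value is even, and a fixed point, a double rise or a valley if it is odd.  A
-- double fall and a valley choose σ⁻¹(i) among the open positions, a double rise
-- and a valley choose σ(i) among the open values.  The chosen position is an
-- antirecord, resp. i is a record, exactly when the choice is the largest one.
-- A valley is the minimum of its cycle exactly when the two choices are the ends
-- of one path, so each σ⁻¹(i) closes a cycle with exactly one σ(i) and vice versa.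
--
-- In P the weight of choosing an open position depends on whether it is a peak
-- or a double fall; in P′ the weight of choosing an open value depends on
-- whether it is a peak or a double rise.  Still, the total weight of all
-- completions of a partial injection is Φ(labels of the open points) * H d k,
-- where the m-th largest open point contributes hi + (m - 1) lo to Φ; this
-- follows by downward induction from Σⱼ pick(j) Φ(w without j) = Φ(w).  Since H
-- is the same for both sums, P n = P′ n = H (2n) 0.  Finally H sums the weighted
-- paths enumerated by the T-fraction: its generating functions are products of
-- the tails of the fraction.

open import Defs
open import Algebra.Bundles using (CommutativeRing)
open import Data.Bool using (Bool; T; true; false; _∧_; not; if_then_else_)
import Data.Bool.Properties as Bool
open import Data.Empty using (⊥)
open import Data.Fin as Fin using (Fin; zero; suc; toℕ; punchIn; punchOut; _≤_; _<_)
import Data.Fin.Permutation as Perm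
import Data.Fin.Properties as Fin
open import Data.List as List
  using (List; []; _∷_; [_]; _++_; map; concatMap; cartesianProductWith; allFin; filterᵇ)
open import Data.List.Membership.Propositional using (_∈_)
open import Data.List.Membership.Propositional.Properties
  using (∈-allFin; ∈-cartesianProductWith⁺; ∈-filter⁺; ∈-filter⁻; ∈-++⁺ˡ; ∈-++⁺ʳ; ∈-++⁻)
open import Data.List.Membership.Propositional.Properties.WithK using (unique∧set⇒bag)
open import Data.List.Properties using (map-∘)
open import Data.List.Relation.Binary.BagAndSetEquality using (∼bag⇒↭)
import Data.List.Relation.Binary.Permutation.Propositional as ↭
open ↭ using (_↭_)
open import Data.List.Relation.Unary.All using ([])
open import Data.List.Relation.Unary.AllPairs using ([]; _∷_)
open import Data.List.Relation.Unary.Any using (here; there)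
open import Data.List.Relation.Unary.Unique.Propositional using (Unique)
open import Data.List.Relation.Unary.Unique.Propositional.Properties
  using (++⁺; allFin⁺; cartesianProductWith⁺; filter⁺)
open import Data.Maybe using (Maybe; just; nothing)
open import Data.Maybe.Properties using (just-injective)
open import Data.Nat as ℕ using (ℕ; zero; suc; _∸_; z≤n; s≤s; _<ᵇ_; _≤ᵇ_; _≡ᵇ_)
import Data.Nat.DivMod as ℕ
import Data.Nat.ListAction as ℕ
import Data.Nat.Properties as ℕ
open import Data.Product using (∃; ∃₂; _×_; _,_; proj₁; proj₂)
open import Data.Sum as Sum using (_⊎_; inj₁; inj₂)
open import Data.Vec as Vec using (Vec; lookup)
open import Data.Vec.Functional as Vector using (Vector; updateAt)
open import Data.Vec.Functional.Properties using (updateAt-updates; updateAt-minimal)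
import Data.Vec.Properties as Vec
open import Function using (_∘_; const; mk⇔; Equivalence)
open import Relation.Binary.Definitions using (tri<; tri≈; tri>)
open import Relation.Binary.PropositionalEquality as ≡ using (_≡_; _≢_; refl)
open import Relation.Nullary using (¬_; does; yes; no; contradiction)
open import Relation.Nullary.Decidable using (T?)

-- Whether a position is an antirecord is not settled when it is read, but when a smaller element
-- picks it as its preimage; the same holds for the record status of the preimage of an open value.
-- This is why the factors of a peak are moved from the peak to its image (for `P`) or to its
-- preimage (for `P′`) before anything is summed. The obstacle is that a step then carries a factor
-- depending on the label of the point it picks, so the labels must be part of the induction
-- hypothesis, which therefore runs over all states and all label vectors. `Φ` charges an open point
-- in advance for its later choice, so `H` meets the factor `x₁ + k u₁` when a peak is opened and
-- nothing when it is picked. Valleys pick two points at once: the labelled one carries the record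
-- factor, and for each labelled choice the other index is summed freely. This sum is `ỹ₁ + k ṽ₁`
-- whatever the path structure, so paths enter the state but not the totals.

T⇒≡ : ∀ {b} → T b → b ≡ true
T⇒≡ = Equivalence.to Bool.T-≡

≡⇒T : ∀ {b} → b ≡ true → T b
≡⇒T = Equivalence.from Bool.T-≡

<ᵇ-true : ∀ {m n} → m ℕ.< n → (m <ᵇ n) ≡ true
<ᵇ-true m<n = T⇒≡ (ℕ.<⇒<ᵇ m<n)

<ᵇ⇒< : ∀ {m n} → (m <ᵇ n) ≡ true → m ℕ.< n
<ᵇ⇒< e = ℕ.<ᵇ⇒< _ _ (≡⇒T e)

<ᵇ-false : ∀ {m n} → n ℕ.≤ m → (m <ᵇ n) ≡ false
<ᵇ-false n≤m = Bool.¬-not λ e → ℕ.≤⇒≯ n≤m (<ᵇ⇒< e)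

≤ᵇ-true : ∀ {m n} → m ℕ.≤ n → (m ≤ᵇ n) ≡ true
≤ᵇ-true m≤n = T⇒≡ (ℕ.≤⇒≤ᵇ m≤n)

≤ᵇ⇒≤ : ∀ {m n} → (m ≤ᵇ n) ≡ true → m ℕ.≤ n
≤ᵇ⇒≤ e = ℕ.≤ᵇ⇒≤ _ _ (≡⇒T e)

≡ᵇ-true : ∀ {m n} → m ≡ n → (m ≡ᵇ n) ≡ true
≡ᵇ-true m≡n = T⇒≡ (ℕ.≡⇒≡ᵇ _ _ m≡n)

≡ᵇ⇒≡ : ∀ {m n} → (m ≡ᵇ n) ≡ true → m ≡ n
≡ᵇ⇒≡ e = ℕ.≡ᵇ⇒≡ _ _ (≡⇒T e)

≡ᵇ-false : ∀ {m n} → m ≢ n → (m ≡ᵇ n) ≡ false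
≡ᵇ-false m≢n = Bool.¬-not λ e → m≢n (≡ᵇ⇒≡ e)

∧⇒ : ∀ {a b} → a ∧ b ≡ true → a ≡ true × b ≡ true
∧⇒ {true} {true} _ = refl , refl

⇒ᵇ-true : ∀ {a b} → (a ≡ true → b ≡ true) → (a ⇒ᵇ b) ≡ true
⇒ᵇ-true {true}  f = f refl
⇒ᵇ-true {false} f = refl

⇒ᵇ-elim : ∀ {a b} → (a ⇒ᵇ b) ≡ true → a ≡ true → b ≡ true
⇒ᵇ-elim {true} e refl = e

odd≡not-even : ∀ n → isOddᵇ n ≡ not (isEvenᵇ n)
odd≡not-even zero          = refl
odd≡not-even (suc zero)    = refl
odd≡not-even (suc (suc n)) = odd≡not-even n

module _ {A : Set} {p : A → Bool} where

  allᵇ-true : ∀ xs → (∀ x → p x ≡ true) → allᵇ p xs ≡ true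
  allᵇ-true []       f = refl
  allᵇ-true (x ∷ xs) f rewrite f x = allᵇ-true xs f

  allᵇ⇒ : ∀ {xs x} → allᵇ p xs ≡ true → x ∈ xs → p x ≡ true
  allᵇ⇒ e (here refl) = proj₁ (∧⇒ e)
  allᵇ⇒ e (there x∈)  = allᵇ⇒ (proj₂ (∧⇒ e)) x∈

allFinᵇ-true : ∀ m {p : Fin m → Bool} → (∀ i → p i ≡ true) → allᵇ p (allFin m) ≡ true
allFinᵇ-true m = allᵇ-true (allFin m)

allFinᵇ⇒ : ∀ {m} {p : Fin m → Bool} → allᵇ p (allFin m) ≡ true → ∀ i → p i ≡ true
allFinᵇ⇒ e i = allᵇ⇒ e (∈-allFin i)

-- D-permutations in propositional form

record DPerm {m} (σ : Fin m → Fin m) : Set where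
  field
    injective : ∀ {i j} → σ i ≡ σ j → i ≡ j
    odd       : ∀ i → isOddᵇ (val i) ≡ true → i ≤ σ i
    even      : ∀ i → isOddᵇ (val i) ≡ false → σ i ≤ i

isDPermᵇ : ∀ {m} → (Fin m → Fin m) → Bool
isDPermᵇ σ = isPermᵇ σ ∧ isDᵇ σ

module _ {m} {σ : Fin m → Fin m} where

  isDPermᵇ⇒DPerm : isDPermᵇ σ ≡ true → DPerm σ
  isDPermᵇ⇒DPerm e = record
    { injective = λ {i} {j} σi≡σj → Fin.toℕ-injective
        (≡ᵇ⇒≡ (⇒ᵇ-elim (allFinᵇ⇒ (allFinᵇ⇒ (proj₁ (∧⇒ e)) i) j) (≡ᵇ-true (≡.cong toℕ σi≡σj))))
    ; odd  = λ i → odd i (allFinᵇ⇒ (proj₂ (∧⇒ e)) i)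
    ; even = λ i → even i (allFinᵇ⇒ (proj₂ (∧⇒ e)) i)
    }
    where
    odd : ∀ i → (if isOddᵇ (val i) then toℕ i ≤ᵇ toℕ (σ i) else toℕ (σ i) ≤ᵇ toℕ i) ≡ true →
          isOddᵇ (val i) ≡ true → i ≤ σ i
    odd i e o rewrite o = ≤ᵇ⇒≤ e
    even : ∀ i → (if isOddᵇ (val i) then toℕ i ≤ᵇ toℕ (σ i) else toℕ (σ i) ≤ᵇ toℕ i) ≡ true →
           isOddᵇ (val i) ≡ false → σ i ≤ i
    even i e o rewrite o = ≤ᵇ⇒≤ e

  DPerm⇒isDPermᵇ : DPerm σ → isDPermᵇ σ ≡ true
  DPerm⇒isDPermᵇ dp = ≡.cong₂ _∧_
    (allFinᵇ-true m λ i → allFinᵇ-true m λ j → ⇒ᵇ-true λ e →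
      ≡ᵇ-true (≡.cong toℕ (DPerm.injective dp {i} {j} (Fin.toℕ-injective (≡ᵇ⇒≡ e)))))
    (allFinᵇ-true m parity)
    where
    parity : ∀ i → (if isOddᵇ (val i) then toℕ i ≤ᵇ toℕ (σ i) else toℕ (σ i) ≤ᵇ toℕ i) ≡ true
    parity i with isOddᵇ (val i) in o
    ... | true  = ≤ᵇ-true (DPerm.odd dp i o)
    ... | false = ≤ᵇ-true (DPerm.even dp i o)

-- A missed value could be punched out of the range, leaving an injection into a smaller finite set.
injective⇒surjective : ∀ {m} (σ : Fin m → Fin m) → (∀ {i j} → σ i ≡ σ j → i ≡ j) →
                       ∀ i → ∃ λ j → σ j ≡ i
injective⇒surjective {zero}  σ injective ()
injective⇒surjective {suc m} σ injective i with Fin.any? (λ j → σ j Fin.≟ i)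
... | yes p = p
... | no ¬p = contradiction
  (Fin.injective⇒≤ {f = λ j → punchOut {i = i} (λ e → ¬p (j , ≡.sym e))}
    (λ {j} {k} e → injective (Fin.punchOut-injective {i = i} (λ e → ¬p (j , ≡.sym e)) (λ e → ¬p (k , ≡.sym e)) e)))
  ℕ.1+n≰n

-- Inverses, iterates and records of permutations

module Injective {m} {σ : Fin m → Fin m} (injective : ∀ {i j} → σ i ≡ σ j → i ≡ j) where

  open Stats σ

  -- The member `j` rules out the default value returned at the end of the list. The search may stop
  -- at an earlier hit, so only the image of the result is described.
  σ-findFrom : ∀ {js i j} → j ∈ js → σ j ≡ i → σ (findFrom js i) ≡ i
  σ-findFrom {k ∷ js} {i} j∈ e with toℕ (σ k) ≡ᵇ toℕ i in eq
  ... | true = Fin.toℕ-injective (≡ᵇ⇒≡ eq)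
  σ-findFrom {k ∷ js} {i} (here refl) refl | false
    with () ← ≡.trans (≡.sym eq) (≡ᵇ-true {toℕ (σ k)} refl)
  σ-findFrom (there j∈) e | false = σ-findFrom j∈ e

  σ-σinv : ∀ i → σ (σinv i) ≡ i
  σ-σinv i with j , e ← injective⇒surjective σ injective i = σ-findFrom (∈-allFin j) e

  σinv-σ : ∀ i → σinv (σ i) ≡ i
  σinv-σ i = injective (σ-σinv (σ i))

  σinv≡ : ∀ {i j} → σ i ≡ j → σinv j ≡ i
  σinv≡ refl = σinv-σ _

  iter-+ : ∀ a b i → iter (a ℕ.+ b) i ≡ iter a (iter b i)
  iter-+ zero    b i = refl
  iter-+ (suc a) b i = ≡.cong σ (iter-+ a b i)

  iter-injective : ∀ a {i j} → iter a i ≡ iter a j → i ≡ j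
  iter-injective zero    e = e
  iter-injective (suc a) e = iter-injective a (injective e)

  -- Two of the iterates with index `0` to `m` agree, and injectivity cancels the smaller index. The
  -- bound `suc r ≤ m` is what lets `cycmin`, which tests indices below `m` only, see the whole
  -- cycle.
  period : ∀ i → ∃ λ r → suc r ℕ.≤ m × iter (suc r) i ≡ i
  period i with a , b , a<b , e ← Fin.pigeonhole (ℕ.n<1+n m) (λ t → iter (toℕ t) i)
    with k , eq ← ℕ.m≤n⇒∃[o]m+o≡n a<b = let r = k ; eq = ≡.trans (ℕ.+-suc (toℕ a) k) eq in
    r , ℕ.≤-trans (ℕ.m+n≤o⇒n≤o (toℕ a) (ℕ.≤-reflexive eq)) (ℕ.s≤s⁻¹ (Fin.toℕ<n b))
    , ≡.sym (iter-injective (toℕ a)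
        (≡.trans e (≡.trans (≡.cong (λ n → iter n i) (≡.sym eq)) (iter-+ (toℕ a) (suc r) i))))

  iter-* : ∀ q r {i} → iter r i ≡ i → iter (q ℕ.* r) i ≡ i
  iter-* zero    r e = refl
  iter-* (suc q) r {i} e = ≡.trans (iter-+ r (q ℕ.* r) i) (≡.trans (≡.cong (iter r) (iter-* q r e)) e)

  cycmin⇒≤iter : ∀ {i} → cycmin i ≡ true → ∀ t → i ≤ iter t i
  cycmin⇒≤iter {i} e t with r , r<m , p ← period i =
    ≡.subst (i ≤_) (≡.sym reduce) (≡.subst (λ k → i ≤ iter k i) (Fin.toℕ-fromℕ< k<m)
      (≤ᵇ⇒≤ (allFinᵇ⇒ e (Fin.fromℕ< k<m))))
    where
    k = t ℕ.% suc r
    k<m : k ℕ.< m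
    k<m = ℕ.<-≤-trans (ℕ.m%n<n t (suc r)) r<m
    reduce : iter t i ≡ iter k i
    reduce = begin
      iter t i                             ≡⟨ ≡.cong (λ n → iter n i) (ℕ.m≡m%n+[m/n]*n t (suc r)) ⟩
      iter (k ℕ.+ t ℕ./ suc r ℕ.* suc r) i ≡⟨ iter-+ k _ i ⟩
      iter k (iter (t ℕ./ suc r ℕ.* suc r) i) ≡⟨ ≡.cong (iter k) (iter-* (t ℕ./ suc r) (suc r) p) ⟩
      iter k i                             ∎
      where open ≡.≡-Reasoning

  cycmin-true : ∀ {i} → (∀ t → i ≤ iter t i) → cycmin i ≡ true
  cycmin-true f = allFinᵇ-true m λ t → ≤ᵇ-true (f (toℕ t))

  cycmin-false : ∀ {i} t → iter t i < i → cycmin i ≡ false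
  cycmin-false {i} t lt = Bool.¬-not λ e → ℕ.<⇒≱ lt (cycmin⇒≤iter e t)

  record-true : ∀ {i} → (∀ j → j < i → σ j < σ i) → record? i ≡ true
  record-true f = allFinᵇ-true m λ j → ⇒ᵇ-true λ e → <ᵇ-true (f j (<ᵇ⇒< e))

  record-false : ∀ {i} j → j < i → σ i < σ j → record? i ≡ false
  record-false j j<i σi<σj = Bool.¬-not λ e →
    ℕ.<⇒≯ σi<σj (<ᵇ⇒< (⇒ᵇ-elim (allFinᵇ⇒ e j) (<ᵇ-true j<i)))

  antirecord-true : ∀ {i} → (∀ j → i < j → σ i < σ j) → antirecord? i ≡ true
  antirecord-true f = allFinᵇ-true m λ j → ⇒ᵇ-true λ e → <ᵇ-true (f j (<ᵇ⇒< e))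

  antirecord-false : ∀ {i} j → i < j → σ j < σ i → antirecord? i ≡ false
  antirecord-false j i<j σj<σi = Bool.¬-not λ e →
    ℕ.<⇒≯ σj<σi (<ᵇ⇒< (⇒ᵇ-elim (allFinᵇ⇒ e j) (<ᵇ-true i<j)))

-- Partial injections and the D-permutations extending them

just≢nothing : ∀ {A : Set} {x : A} {m} → m ≡ just x → m ≢ nothing
just≢nothing refl ()

module _ {M : ℕ} where

  -- The part of an image visible at threshold `d`: `nothing` stands for a value below `d`.
  upFrom : ℕ → Fin M → Maybe (Fin M)
  upFrom d x = if d ≤ᵇ toℕ x then just x else nothing

  upFrom-just : ∀ {d x} → d ℕ.≤ toℕ x → upFrom d x ≡ just x
  upFrom-just d≤x rewrite ≤ᵇ-true d≤x = refl

  upFrom-nothing : ∀ {d x} → toℕ x ℕ.< d → upFrom d x ≡ nothing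
  upFrom-nothing {d} {x} x<d rewrite Bool.¬-not {d ≤ᵇ toℕ x} (λ e → ℕ.<⇒≱ x<d (≤ᵇ⇒≤ e)) = refl

  upFrom-just⁻ : ∀ {d x y} → upFrom d x ≡ just y → x ≡ y × d ℕ.≤ toℕ x
  upFrom-just⁻ {d} {x} e with d ≤ᵇ toℕ x in eq
  upFrom-just⁻ refl | true = refl , ≤ᵇ⇒≤ eq

  upFrom-nothing⁻ : ∀ {d x} → upFrom d x ≡ nothing → toℕ x ℕ.< d
  upFrom-nothing⁻ {d} {x} e with d ≤ᵇ toℕ x in eq
  ... | false = ℕ.≰⇒> λ d≤x → contradiction (≡.trans (≡.sym eq) (≤ᵇ-true d≤x)) λ ()

  upFrom-suc : ∀ {d x} → toℕ x ≢ d → upFrom (suc d) x ≡ upFrom d x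
  upFrom-suc {d} {x} x≢d with d ℕ.≤? toℕ x
  ... | yes d≤x = ≡.trans (upFrom-just (ℕ.≤∧≢⇒< d≤x (x≢d ∘ ≡.sym))) (≡.sym (upFrom-just d≤x))
  ... | no d≰x  = ≡.trans (upFrom-nothing (ℕ.m≤n⇒m≤1+n (ℕ.≰⇒> d≰x))) (≡.sym (upFrom-nothing (ℕ.≰⇒> d≰x)))

  PartialMap : Set
  PartialMap = Fin M → Maybe (Fin M)

  Open : ℕ → PartialMap → Fin M → Set
  Open d f p = d ℕ.≤ toℕ p × f p ≡ nothing

  -- The order makes the last index the largest open point and gives index `zero` to a newly added
  -- point, which is the smallest.
  record OpenList (d k : ℕ) (f : PartialMap) : Set where
    field
      elem     : Fin k → Fin M
      sound    : ∀ j → Open d f (elem j)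
      complete : ∀ {p} → Open d f p → ∃ λ j → elem j ≡ p
      sorted   : ∀ {j j′} → j < j′ → elem j < elem j′

    elem-injective : ∀ {j j′} → elem j ≡ elem j′ → j ≡ j′
    elem-injective {j} {j′} e with Fin.<-cmp j j′
    ... | tri< j<j′ _ _ = contradiction (≡.cong toℕ e) (ℕ.<⇒≢ (sorted j<j′))
    ... | tri≈ _ j≡j′ _ = j≡j′
    ... | tri> _ _ j>j′ = contradiction (≡.cong toℕ (≡.sym e)) (ℕ.<⇒≢ (sorted j>j′))

    elem-mono : ∀ {j j′} → j ≤ j′ → elem j ≤ elem j′
    elem-mono {j} {j′} j≤j′ with j Fin.≟ j′
    ... | yes refl = ℕ.≤-refl
    ... | no j≢j′  = ℕ.<⇒≤ (sorted (ℕ.≤∧≢⇒< j≤j′ (j≢j′ ∘ Fin.toℕ-injective)))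

  open OpenList

  addOpen : ∀ {d k f} (i : Fin M) → toℕ i ≡ d → f i ≡ nothing →
            OpenList (suc d) k f → OpenList d (suc k) f
  addOpen {d} {k} {f} i i≡d fi L = record
    { elem = i Vector.∷ elem L ; sound = snd ; complete = cmp ; sorted = srt }
    where
    snd : ∀ j → Open d f ((i Vector.∷ elem L) j)
    snd zero    = ℕ.≤-reflexive (≡.sym i≡d) , fi
    snd (suc j) with d<p , fp ← sound L j = ℕ.<⇒≤ d<p , fp
    cmp : ∀ {p} → Open d f p → ∃ λ j → (i Vector.∷ elem L) j ≡ p
    cmp {p} (d≤p , fp) with i Fin.≟ p
    ... | yes i≡p = zero , i≡p
    ... | no i≢p with j , e ← complete L 
      (ℕ.≤∧≢⇒< d≤p (λ d≡p → i≢p (Fin.toℕ-injective (≡.trans i≡d d≡p))) , fp) = suc j , e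
    srt : ∀ {j j′} → j < j′ → (i Vector.∷ elem L) j < (i Vector.∷ elem L) j′
    srt {zero}  {suc j′} _ = ℕ.≤-<-trans (ℕ.≤-reflexive i≡d) (proj₁ (sound L j′))
    srt {suc j} {suc j′} (s≤s j<j′) = sorted L j<j′

  punchIn-mono-< : ∀ {n} (i : Fin (suc n)) {j j′ : Fin n} → j < j′ → punchIn i j < punchIn i j′
  punchIn-mono-< i {j} {j′} j<j′ = ℕ.≤∧≢⇒< (Fin.punchIn-mono-≤ i j j′ (ℕ.<⇒≤ j<j′))
    λ e → ℕ.<⇒≢ j<j′ (≡.cong toℕ (Fin.punchIn-injective i j j′ (Fin.toℕ-injective e)))

  removeOpen : ∀ {d k f f′} (L : OpenList d (suc k) f) (j : Fin (suc k)) →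
               f′ (elem L j) ≢ nothing → (∀ {p} → p ≢ elem L j → f′ p ≡ f p) →
               OpenList d k f′
  removeOpen {d} {k} {f} {f′} L j closed same = record
    { elem     = elem L ∘ punchIn j
    ; sound    = λ x → proj₁ (sound L (punchIn j x))
                     , ≡.trans (same λ e → Fin.punchInᵢ≢i j x (elem-injective L e)) (proj₂ (sound L (punchIn j x)))
    ; complete = cmp
    ; sorted   = sorted L ∘ punchIn-mono-< j
    }
    where
    cmp : ∀ {p} → Open d f′ p → ∃ λ x → elem L (punchIn j x) ≡ p
    cmp {p} (d≤p , f′p) with p Fin.≟ elem L j
    ... | yes refl = contradiction f′p closed
    ... | no p≢ with x , e ← complete L (d≤p , ≡.trans (≡.sym (same p≢)) f′p) =
      punchOut j≢x , ≡.trans (≡.cong (elem L) (Fin.punchIn-punchOut j≢x)) e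
      where
      j≢x : j ≢ x
      j≢x refl = p≢ (≡.sym e)

  -- The empty path matters: a newly added isolated point is an open value and an open position
  -- joined by it.
  data Path (f : PartialMap) : Fin M → Fin M → Set where
    []  : ∀ {x} → Path f x x
    _∷_ : ∀ {x y z} → f x ≡ just y → Path f y z → Path f x z

  _++ᴾ_ : ∀ {f x y z} → Path f x y → Path f y z → Path f x z
  []      ++ᴾ q = q
  (e ∷ p) ++ᴾ q = e ∷ (p ++ᴾ q)

  mapᴾ : ∀ {f f′ x y} → (∀ {p q} → f p ≡ just q → f′ p ≡ just q) → Path f x y → Path f′ x y
  mapᴾ g []      = []
  mapᴾ g (e ∷ p) = g e ∷ mapᴾ g p

  Path-end-unique : ∀ {f x y z} → f y ≡ nothing → f z ≡ nothing → Path f x y → Path f x z → y ≡ z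
  Path-end-unique fy fz []      []      = refl
  Path-end-unique fy fz []      (e ∷ _) = contradiction fy (just≢nothing e)
  Path-end-unique fy fz (e ∷ _) []      = contradiction fz (just≢nothing e)
  Path-end-unique fy fz (e ∷ p) (e′ ∷ q) with refl ← just-injective (≡.trans (≡.sym e) e′) =
    Path-end-unique fy fz p q

  -- A partial injection (out, with inverse inn) of {d, ..., M - 1} with k points
  -- outside its domain and k points outside its range.
  record State (d k : ℕ) : Set where
    field
      out inn   : PartialMap
      out⇒inn   : ∀ {p u} → out p ≡ just u → inn u ≡ just p
      inn⇒out   : ∀ {p u} → inn u ≡ just p → out p ≡ just u
      out-range : ∀ {p u} → out p ≡ just u → d ℕ.≤ toℕ p × d ℕ.≤ toℕ u
      domOpen   : OpenList d k out
      ranOpen   : OpenList d k inn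
      -- That the path through an open point ends is stored and updated at each link, which avoids a
      -- termination argument by counting points.
      pathEnd   : ∀ {u} → Open d inn u → ∃ λ p → Open d out p × Path out u p
      pathStart : ∀ {p} → Open d out p → ∃ λ u → Open d inn u × Path out u p

    D R : Fin k → Fin M
    D = elem domOpen
    R = elem ranOpen

    reverseᴾ : ∀ {u p} → Path out u p → Path inn p u
    reverseᴾ []      = []
    reverseᴾ (e ∷ p) = reverseᴾ p ++ᴾ (out⇒inn e ∷ [])

    Path-start-unique : ∀ {u v p} → inn u ≡ nothing → inn v ≡ nothing → Path out u p → Path out v p → u ≡ v
    Path-start-unique iu iv p q = Path-end-unique iu iv (reverseᴾ p) (reverseᴾ q)

  open State

  empty : State M 0
  empty = record
    { out = const nothing ; inn = const nothing
    ; out⇒inn = λ () ; inn⇒out = λ () ; out-range = λ ()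
    ; domOpen = none ; ranOpen = none
    ; pathEnd   = λ {u} (M≤u , _) → contradiction (Fin.toℕ<n u) (ℕ.≤⇒≯ M≤u)
    ; pathStart = λ {p} (M≤p , _) → contradiction (Fin.toℕ<n p) (ℕ.≤⇒≯ M≤p)
    }
    where
    none : OpenList M 0 (const nothing)
    none = record
      { elem = λ () ; sound = λ () ; sorted = λ { {()} }
      ; complete = λ {p} (M≤p , _) → contradiction (Fin.toℕ<n p) (ℕ.≤⇒≯ M≤p) }

  module _ {d k} (S : State (suc d) k) (i : Fin M) (i≡d : toℕ i ≡ d) where

    fresh-out : out S i ≡ nothing
    fresh-out with out S i in e
    ... | nothing = refl
    ... | just u  = contradiction (≡.sym i≡d) (ℕ.<⇒≢ (proj₁ (out-range S e)))

    fresh-inn : inn S i ≡ nothing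
    fresh-inn with inn S i in e
    ... | nothing = refl
    ... | just p  = contradiction (≡.sym i≡d) (ℕ.<⇒≢ (proj₂ (out-range S (inn⇒out S e))))

    -- All five roles of the next element start from this isolated point: a peak adds no link, a
    -- fixed point, double fall or double rise one, a valley two.
    addPoint : State d (suc k)
    addPoint = record
      { out = out S ; inn = inn S ; out⇒inn = out⇒inn S ; inn⇒out = inn⇒out S
      ; out-range = λ e → let d<p , d<u = out-range S e in ℕ.<⇒≤ d<p , ℕ.<⇒≤ d<u
      ; domOpen = addOpen i i≡d fresh-out (domOpen S)
      ; ranOpen = addOpen i i≡d fresh-inn (ranOpen S)
      ; pathEnd = end ; pathStart = start
      }
      where
      i-open : d ℕ.≤ toℕ i
      i-open = ℕ.≤-reflexive (≡.sym i≡d)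
      older : ∀ {p} → d ℕ.≤ toℕ p → p ≢ i → suc d ℕ.≤ toℕ p
      older d≤p p≢i = ℕ.≤∧≢⇒< d≤p λ d≡p → p≢i (Fin.toℕ-injective (≡.trans (≡.sym d≡p) (≡.sym i≡d)))
      end : ∀ {u} → Open d (inn S) u → ∃ λ p → Open d (out S) p × Path (out S) u p
      end {u} (d≤u , iu) with u Fin.≟ i
      ... | yes refl = i , (i-open , fresh-out) , []
      ... | no u≢i with p , (d<p , op) , path ← pathEnd S (older d≤u u≢i , iu) = p , (ℕ.<⇒≤ d<p , op) , path
      start : ∀ {p} → Open d (out S) p → ∃ λ u → Open d (inn S) u × Path (out S) u p
      start {p} (d≤p , op) with p Fin.≟ i
      ... | yes refl = i , (i-open , fresh-inn) , []
      ... | no p≢i with u , (d<u , iu) , path ← pathStart S (older d≤p p≢i , op) = u , (ℕ.<⇒≤ d<u , iu) , path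

  module Link {d k} (S : State d (suc k)) (j l : Fin (suc k)) where

    p₀ u₀ : Fin M
    p₀ = D S j
    u₀ = R S l

    out′ inn′ : PartialMap
    out′ = updateAt (out S) p₀ (const (just u₀))
    inn′ = updateAt (inn S) u₀ (const (just p₀))

    out′-p₀ : out′ p₀ ≡ just u₀
    out′-p₀ = updateAt-updates p₀ (out S)

    inn′-u₀ : inn′ u₀ ≡ just p₀
    inn′-u₀ = updateAt-updates u₀ (inn S)

    out′-old : ∀ {q} → q ≢ p₀ → out′ q ≡ out S q
    out′-old q≢ = updateAt-minimal _ p₀ (out S) q≢

    inn′-old : ∀ {q} → q ≢ u₀ → inn′ q ≡ inn S q
    inn′-old q≢ = updateAt-minimal _ u₀ (inn S) q≢

    out-p₀ : out S p₀ ≡ nothing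
    out-p₀ = proj₂ (sound (domOpen S) j)

    inn-u₀ : inn S u₀ ≡ nothing
    inn-u₀ = proj₂ (sound (ranOpen S) l)

    out⊆out′ : ∀ {q w} → out S q ≡ just w → out′ q ≡ just w
    out⊆out′ e = ≡.trans (out′-old λ { refl → just≢nothing e out-p₀ }) e

    inn⊆inn′ : ∀ {q w} → inn S q ≡ just w → inn′ q ≡ just w
    inn⊆inn′ e = ≡.trans (inn′-old λ { refl → just≢nothing e inn-u₀ }) e

    out′-cases : ∀ {q w} → out′ q ≡ just w → (q ≡ p₀ × w ≡ u₀) ⊎ out S q ≡ just w
    out′-cases {q} e with q Fin.≟ p₀
    ... | yes refl = inj₁ (refl , just-injective (≡.trans (≡.sym e) out′-p₀))
    ... | no q≢    = inj₂ (≡.trans (≡.sym (out′-old q≢)) e)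

    inn′-cases : ∀ {q w} → inn′ q ≡ just w → (q ≡ u₀ × w ≡ p₀) ⊎ inn S q ≡ just w
    inn′-cases {q} e with q Fin.≟ u₀
    ... | yes refl = inj₁ (refl , just-injective (≡.trans (≡.sym e) inn′-u₀))
    ... | no q≢    = inj₂ (≡.trans (≡.sym (inn′-old q≢)) e)

    open-out : ∀ {q} → Open d out′ q → q ≢ p₀ × Open d (out S) q
    open-out (d≤q , oq) = q≢ , d≤q , ≡.trans (≡.sym (out′-old q≢)) oq
      where q≢ = λ { refl → just≢nothing out′-p₀ oq }

    open-inn : ∀ {q} → Open d inn′ q → q ≢ u₀ × Open d (inn S) q
    open-inn (d≤q , iq) = q≢ , d≤q , ≡.trans (≡.sym (inn′-old q≢)) iq
      where q≢ = λ { refl → just≢nothing inn′-u₀ iq }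

    link : State d k
    link = record
      { out = out′ ; inn = inn′ ; out⇒inn = oi ; inn⇒out = io ; out-range = range
      ; domOpen = removeOpen (domOpen S) j (just≢nothing out′-p₀) out′-old
      ; ranOpen = removeOpen (ranOpen S) l (just≢nothing inn′-u₀) inn′-old
      ; pathEnd = end ; pathStart = start
      }
      where
      oi : ∀ {q w} → out′ q ≡ just w → inn′ w ≡ just q
      oi e with out′-cases e
      ... | inj₁ (refl , refl) = inn′-u₀
      ... | inj₂ e′ = inn⊆inn′ (out⇒inn S e′)
      io : ∀ {q w} → inn′ w ≡ just q → out′ q ≡ just w
      io e with inn′-cases e
      ... | inj₁ (refl , refl) = out′-p₀
      ... | inj₂ e′ = out⊆out′ (inn⇒out S e′)
      range : ∀ {q w} → out′ q ≡ just w → d ℕ.≤ toℕ q × d ℕ.≤ toℕ w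
      range e with out′-cases e
      ... | inj₁ (refl , refl) = proj₁ (sound (domOpen S) j) , proj₁ (sound (ranOpen S) l)
      ... | inj₂ e′ = out-range S e′
      end : ∀ {v} → Open d inn′ v → ∃ λ p → Open d out′ p × Path out′ v p
      end {v} ov with v≢u₀ , ov′@(_ , iv) ← open-inn ov with pathEnd S ov′
      ... | p , (d≤p , op) , path with p Fin.≟ p₀
      ...   | no p≢   = p , (d≤p , ≡.trans (out′-old p≢) op) , mapᴾ out⊆out′ path
      -- The old path of `v` stopped at `p₀` and now continues along the path of `u₀`. That path
      -- cannot end at `p₀` as well, since then `v` and `u₀` would start paths with the same end and
      -- coincide, although `v` is still open.
      ...   | yes refl with q , (d≤q , oq) , path′ ← pathEnd S (sound (ranOpen S) l) =
        q , (d≤q , ≡.trans (out′-old q≢) oq) , mapᴾ out⊆out′ path ++ᴾ (out′-p₀ ∷ mapᴾ out⊆out′ path′)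
        where
        q≢ : q ≢ p₀
        q≢ refl = v≢u₀ (Path-start-unique S iv inn-u₀ path path′)
      start : ∀ {q} → Open d out′ q → ∃ λ v → Open d inn′ v × Path out′ v q
      start {q} oq with q≢p₀ , oq′@(_ , oq″) ← open-out oq with pathStart S oq′
      ... | v , (d≤v , iv) , path with v Fin.≟ u₀
      ...   | no v≢   = v , (d≤v , ≡.trans (inn′-old v≢) iv) , mapᴾ out⊆out′ path
      ...   | yes refl with w , (d≤w , iw) , path′ ← pathStart S (sound (domOpen S) j) =
        w , (d≤w , ≡.trans (inn′-old w≢) iw) , mapᴾ out⊆out′ path′ ++ᴾ (out′-p₀ ∷ mapᴾ out⊆out′ path)
        where
        w≢ : w ≢ u₀
        w≢ refl = q≢p₀ (Path-end-unique oq″ out-p₀ path path′)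

  open Link using (link)

  -- The common shape of the five moves: `a` and `b` are the visible image and preimage of `i`, and
  -- an older point keeps its entry unless it was open and is joined to `i`.
  record Extends {d k k′} (S : State (suc d) k) (S′ : State d k′) (i : Fin M) (a b : Maybe (Fin M)) : Set where
    field
      out-i   : out S′ i ≡ a
      inn-i   : inn S′ i ≡ b
      out-old : ∀ {p} → d ℕ.< toℕ p → (out S p ≡ nothing × out S′ p ≡ just i) ⊎ out S′ p ≡ out S p
      inn-old : ∀ {p} → d ℕ.< toℕ p → (inn S p ≡ nothing × inn S′ p ≡ just i) ⊎ inn S′ p ≡ inn S p

  module _ {d} (i : Fin M) (i≡d : toℕ i ≡ d) where

    later : ∀ {p} → d ℕ.< toℕ p → p ≢ i
    later d<p refl = ℕ.<⇒≢ d<p (≡.sym i≡d)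

    peakState : ∀ {k} → State (suc d) k → State d (suc k)
    peakState S = addPoint S i i≡d

    fixState : ∀ {k} → State (suc d) k → State d k
    fixState S = link (addPoint S i i≡d) zero zero

    dfallState : ∀ {k} → State (suc d) (suc k) → Fin (suc k) → State d (suc k)
    dfallState S j = link (addPoint S i i≡d) (suc j) zero

    driseState : ∀ {k} → State (suc d) (suc k) → Fin (suc k) → State d (suc k)
    driseState S l = link (addPoint S i i≡d) zero (suc l)

    -- After the first link `i` is still open position `zero`, while the open values are again those
    -- of `S`; hence the second link uses `zero` and the unshifted `l`.
    valleyState : ∀ {k} → State (suc d) (suc k) → Fin (suc k) → Fin (suc k) → State d k
    valleyState S j l = link (dfallState S j) zero l

    D-later : ∀ {k} (S : State (suc d) k) j → i ≢ D S j
    D-later S j = later (proj₁ (sound (domOpen S) j)) ∘ ≡.sym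

    R-later : ∀ {k} (S : State (suc d) k) l → i ≢ R S l
    R-later S l = later (proj₁ (sound (ranOpen S) l)) ∘ ≡.sym

    peakExtends : ∀ {k} (S : State (suc d) k) → Extends S (peakState S) i nothing nothing
    peakExtends S = record
      { out-i = fresh-out S i i≡d ; inn-i = fresh-inn S i i≡d
      ; out-old = λ _ → inj₂ refl ; inn-old = λ _ → inj₂ refl }

    fixExtends : ∀ {k} (S : State (suc d) k) → Extends S (fixState S) i (just i) (just i)
    fixExtends S = record
      { out-i = out′-p₀ ; inn-i = inn′-u₀
      ; out-old = λ d<p → inj₂ (out′-old (later d<p)) ; inn-old = λ d<p → inj₂ (inn′-old (later d<p)) }
      where open Link (addPoint S i i≡d) zero zero

    dfallExtends : ∀ {k} (S : State (suc d) (suc k)) j → Extends S (dfallState S j) i nothing (just (D S j))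
    dfallExtends S j = record
      { out-i = ≡.trans (out′-old (D-later S j)) (fresh-out S i i≡d) ; inn-i = inn′-u₀
      ; out-old = old ; inn-old = λ d<p → inj₂ (inn′-old (later d<p)) }
      where
      open Link (addPoint S i i≡d) (suc j) zero
      old : ∀ {p} → d ℕ.< toℕ p → (out S p ≡ nothing × out′ p ≡ just i) ⊎ out′ p ≡ out S p
      old {p} _ with p Fin.≟ p₀
      ... | yes refl = inj₁ (out-p₀ , out′-p₀)
      ... | no p≢    = inj₂ (out′-old p≢)

    driseExtends : ∀ {k} (S : State (suc d) (suc k)) l → Extends S (driseState S l) i (just (R S l)) nothing
    driseExtends S l = record
      { out-i = out′-p₀ ; inn-i = ≡.trans (inn′-old (R-later S l)) (fresh-inn S i i≡d)
      ; out-old = λ d<p → inj₂ (out′-old (later d<p)) ; inn-old = old }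
      where
      open Link (addPoint S i i≡d) zero (suc l)
      old : ∀ {p} → d ℕ.< toℕ p → (inn S p ≡ nothing × inn′ p ≡ just i) ⊎ inn′ p ≡ inn S p
      old {p} _ with p Fin.≟ u₀
      ... | yes refl = inj₁ (inn-u₀ , inn′-u₀)
      ... | no p≢    = inj₂ (inn′-old p≢)

    valleyExtends : ∀ {k} (S : State (suc d) (suc k)) j l →
                    Extends S (valleyState S j l) i (just (R S l)) (just (D S j))
    valleyExtends S j l = record
      { out-i = out′-p₀ ; inn-i = ≡.trans (inn′-old (R-later S l)) (inn-i E)
      ; out-old = oldₒ ; inn-old = oldᵢ }
      where
      E = dfallExtends S j
      open Extends
      open Link (dfallState S j) zero l
      oldₒ : ∀ {p} → d ℕ.< toℕ p → (out S p ≡ nothing × out′ p ≡ just i) ⊎ out′ p ≡ out S p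
      oldₒ d<p with out-old E d<p
      ... | inj₁ (e , e′) = inj₁ (e , ≡.trans (out′-old (later d<p)) e′)
      ... | inj₂ e        = inj₂ (≡.trans (out′-old (later d<p)) e)
      oldᵢ : ∀ {p} → d ℕ.< toℕ p → (inn S p ≡ nothing × inn′ p ≡ just i) ⊎ inn′ p ≡ inn S p
      oldᵢ {p} d<p with p Fin.≟ u₀
      ... | yes refl = inj₁ (proj₂ (sound (ranOpen S) l) , inn′-u₀)
      ... | no p≢ with inn-old E d<p
      ...   | inj₁ (e , e′) = inj₁ (e , ≡.trans (inn′-old p≢) e′)
      ...   | inj₂ e        = inj₂ (≡.trans (inn′-old p≢) e)

  -- The D-permutations restricting to `S` at threshold `d`. They are vectors, so that pointwise
  -- agreement gives equality, as duplicate-free lists of them require.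
  record Class {d k} (S : State d k) (v : Vec (Fin M) M) : Set where
    field
      dperm      : DPerm (lookup v)
      out-agrees : ∀ {p} → d ℕ.≤ toℕ p → out S p ≡ upFrom d (lookup v p)
      inn-agrees : ∀ {u} → d ℕ.≤ toℕ u → inn S u ≡ upFrom d (Stats.σinv (lookup v) u)

    open Injective (DPerm.injective dperm) public

  open Class

  -- The one condition that membership in the class of a move adds to membership in the class of
  -- `S`.
  Hook : ∀ (i : Fin M) (a b : Maybe (Fin M)) → Vec (Fin M) M → Set
  Hook i a b v = a ≡ upFrom (toℕ i) (lookup v i) × b ≡ upFrom (toℕ i) (Stats.σinv (lookup v) i)

  -- A class may be empty, so the parity condition is also kept on the partial map itself. It is
  -- what makes the total map reached at threshold `0` a D-permutation in `Class₀-inhabited`.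
  record Parity {d k} (S : State d k) : Set where
    field
      odd-out  : ∀ {p} → d ℕ.≤ toℕ p → isOddᵇ (val p) ≡ true → ∃ λ u → out S p ≡ just u × p ≤ u
      even-out : ∀ {p u} → isOddᵇ (val p) ≡ false → out S p ≡ just u → u ≤ p

  open Parity

  module _ {i : Fin M} (g g′ : PartialMap) (f : Fin M → Fin M) {p : Fin M} where

    agrees-restrict : (g p ≡ nothing × g′ p ≡ just i) ⊎ g′ p ≡ g p →
                      (∀ {u} → g p ≡ just u → i < u) →
                      g′ p ≡ upFrom (toℕ i) (f p) → g p ≡ upFrom (suc (toℕ i)) (f p)
    agrees-restrict (inj₁ (gp , g′p)) range e with refl , _ ← upFrom-just⁻ {toℕ i} (≡.trans (≡.sym e) g′p) =
      ≡.trans gp (≡.sym (upFrom-nothing ℕ.≤-refl))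
    agrees-restrict (inj₂ same) range e with f p Fin.≟ i
    ... | no ≢i   = ≡.trans (≡.sym same) (≡.trans e (≡.sym (upFrom-suc (≢i ∘ Fin.toℕ-injective))))
    ... | yes ≡i = contradiction (≡.cong toℕ (≡.sym ≡i))
      (ℕ.<⇒≢ (range (≡.trans (≡.sym same) (≡.trans e (upFrom-just (ℕ.≤-reflexive (≡.cong toℕ (≡.sym ≡i))))))))

    agrees-extend : (g p ≡ nothing × g′ p ≡ just i) ⊎ g′ p ≡ g p →
                    (g′ p ≡ just i → f p ≡ i) → (f p ≡ i → g′ p ≡ just i) →
                    g p ≡ upFrom (suc (toℕ i)) (f p) → g′ p ≡ upFrom (toℕ i) (f p)
    agrees-extend old to from e with f p Fin.≟ i
    ... | yes refl = ≡.trans (from refl) (≡.sym (upFrom-just ℕ.≤-refl))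
    agrees-extend (inj₁ (_ , g′p)) to from e | no ≢i = contradiction (to g′p) ≢i
    agrees-extend (inj₂ same)      to from e | no ≢i = ≡.trans same (≡.trans e (upFrom-suc (≢i ∘ Fin.toℕ-injective)))

  module _ {k k′} {i : Fin M} {S : State (suc (toℕ i)) k} {S′ : State (toℕ i) k′} {a b} (E : Extends S S′ i a b) where

    open Extends E

    -- Together with `extendClass`: the class of `S′` is the class of `S` cut down by what the
    -- permutation does at `i`. The moves therefore split the class of `S` according to the hook.
    restrictClass : ∀ {v} → Class S′ v → Class S v × Hook i a b v
    restrictClass {v} C = record
      { dperm = dperm C
      ; out-agrees = λ i<p → agrees-restrict (out S) (out S′) (lookup v) (out-old i<p)
          (proj₂ ∘ out-range S) (out-agrees C (ℕ.<⇒≤ i<p))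
      ; inn-agrees = λ i<p → agrees-restrict (inn S) (inn S′) (Stats.σinv (lookup v)) (inn-old i<p)
          (proj₁ ∘ out-range S ∘ inn⇒out S) (inn-agrees C (ℕ.<⇒≤ i<p))
      } , ≡.trans (≡.sym out-i) (out-agrees C ℕ.≤-refl) , ≡.trans (≡.sym inn-i) (inn-agrees C ℕ.≤-refl)

    extendClass : ∀ {v} → Class S v → Hook i a b v → Class S′ v
    extendClass {v} C (a≡ , b≡) = record { dperm = dperm C ; out-agrees = outs ; inn-agrees = inns }
      where
      σ = lookup v
      open Stats σ using (σinv)
      outs : ∀ {p} → toℕ i ℕ.≤ toℕ p → out S′ p ≡ upFrom (toℕ i) (σ p)
      outs {p} i≤p with p Fin.≟ i
      ... | yes refl = ≡.trans out-i a≡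
      -- Whether an older `p` is sent to `i` is decided by the `inn` entry at `i`, since `p` must
      -- then be the visible preimage of `i`. The other direction below is dual.
      ... | no p≢i   = agrees-extend (out S) (out S′) σ (out-old i<p)
        (λ e → ≡.trans (≡.cong σ (≡.sym (proj₁ (upFrom-just⁻ {toℕ i}
                         (≡.trans (≡.sym (≡.trans inn-i b≡)) (out⇒inn S′ e))))))
                       (σ-σinv C i))
        (λ e → inn⇒out S′ (≡.trans (≡.trans inn-i b≡)
                 (≡.trans (≡.cong (upFrom (toℕ i)) (σinv≡ C e)) (upFrom-just i≤p))))
        (out-agrees C i<p)
        where i<p = ℕ.≤∧≢⇒< i≤p (p≢i ∘ ≡.sym ∘ Fin.toℕ-injective)
      inns : ∀ {p} → toℕ i ℕ.≤ toℕ p → inn S′ p ≡ upFrom (toℕ i) (σinv p)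
      inns {p} i≤p with p Fin.≟ i
      ... | yes refl = ≡.trans inn-i b≡
      ... | no p≢i   = agrees-extend (inn S) (inn S′) σinv (inn-old i<p)
        (λ e → σinv≡ C (proj₁ (upFrom-just⁻ {toℕ i} (≡.trans (≡.sym (≡.trans out-i a≡)) (inn⇒out S′ e)))))
        (λ e → out⇒inn S′ (≡.trans (≡.trans out-i a≡)
                 (≡.trans (≡.cong (upFrom (toℕ i)) (≡.trans (≡.cong σ (≡.sym e)) (σ-σinv C p))) (upFrom-just i≤p))))
        (inn-agrees C i<p)
        where i<p = ℕ.≤∧≢⇒< i≤p (p≢i ∘ ≡.sym ∘ Fin.toℕ-injective)

    extendParity : Parity S → (isOddᵇ (val i) ≡ true → ∃ λ u → a ≡ just u × i ≤ u) →
                   (∀ {u} → isOddᵇ (val i) ≡ false → a ≡ just u → u ≤ i) → Parity S′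
    extendParity P odd-i even-i = record { odd-out = odds ; even-out = evens }
      where
      odds : ∀ {p} → toℕ i ℕ.≤ toℕ p → isOddᵇ (val p) ≡ true → ∃ λ u → out S′ p ≡ just u × p ≤ u
      odds {p} i≤p o with p Fin.≟ i
      ... | yes refl with u , e , i≤u ← odd-i o = u , ≡.trans out-i e , i≤u
      ... | no p≢i with i<p ← ℕ.≤∧≢⇒< i≤p (p≢i ∘ ≡.sym ∘ Fin.toℕ-injective)
        with u , e , p≤u ← odd-out P i<p o with out-old i<p
      ...   | inj₁ (e′ , _) = contradiction e′ (just≢nothing e)
      ...   | inj₂ same     = u , ≡.trans same e , p≤u
      evens : ∀ {p u} → isOddᵇ (val p) ≡ false → out S′ p ≡ just u → u ≤ p
      evens {p} o e with p Fin.≟ i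
      ... | yes refl = even-i o (≡.trans (≡.sym out-i) e)
      ... | no p≢i with i<p ← ℕ.≤∧≢⇒< (proj₁ (out-range S′ e)) (p≢i ∘ ≡.sym ∘ Fin.toℕ-injective) with out-old i<p
      ...   | inj₁ (_ , e′) with refl ← just-injective (≡.trans (≡.sym e) e′) = ℕ.<⇒≤ i<p
      ...   | inj₂ same     = even-out P o (≡.trans (≡.sym same) e)

  Class₀-unique : ∀ {k} {S : State 0 k} {v v′} → Class S v → Class S v′ → v ≡ v′
  Class₀-unique {v = v} {v′} C C′ = ≡.trans (≡.sym (Vec.tabulate∘lookup v))
    (≡.trans (Vec.tabulate-cong λ p → just-injective (≡.trans (≡.sym (out-agrees C z≤n)) (out-agrees C′ z≤n)))
           (Vec.tabulate∘lookup v′))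

  Class₀-empty : ∀ {k} {S : State 0 (suc k)} {v} → ¬ Class S v
  Class₀-empty {S = S} C = just≢nothing (out-agrees C z≤n) (proj₂ (sound (domOpen S) zero))

  Class₀-inhabited : (S : State 0 0) → Parity S → ∃ (Class S)
  Class₀-inhabited S P = Vec.tabulate f , record
    { dperm = dp ; out-agrees = λ {p} _ → out-σ p
    ; inn-agrees = λ {u} _ → out⇒inn S
        (≡.trans (out-σ (σinv u)) (≡.cong just (Injective.σ-σinv (DPerm.injective dp) u))) }
    where
    total : ∀ p → ∃ λ u → out S p ≡ just u
    total p with out S p in e
    ... | just u  = u , refl
    ... | nothing with () , _ ← complete (domOpen S) (z≤n , e)
    f = proj₁ ∘ total
    σ = lookup (Vec.tabulate f)
    open Stats σ using (σinv)
    out-σ : ∀ p → out S p ≡ just (σ p)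
    out-σ p = ≡.trans (proj₂ (total p)) (≡.cong just (≡.sym (Vec.lookup∘tabulate f p)))
    dp : DPerm σ
    dp = record
      { injective = λ {p} {q} e → just-injective (≡.trans (≡.sym (out⇒inn S (out-σ p)))
                                    (≡.trans (≡.cong (inn S) e) (out⇒inn S (out-σ q))))
      ; odd  = λ p o → let u , e , p≤u = odd-out P z≤n o in
                 ≡.subst (p ≤_) (just-injective (≡.trans (≡.sym e) (out-σ p))) p≤u
      ; even = λ p o → even-out P o (out-σ p)
      }

  module _ {k} {i : Fin M} {S : State (suc (toℕ i)) k} {v} (C : Class S v) where

    private
      σ = lookup v
      d = toℕ i
    open Stats σ using (σinv)

    small-dom : ∀ {p} → d ℕ.< toℕ p → toℕ (σ p) ℕ.≤ d → ∃ λ j → D S j ≡ p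
    small-dom d<p σp≤d = complete (domOpen S) (d<p , ≡.trans (out-agrees C d<p) (upFrom-nothing (s≤s σp≤d)))

    small-ran : ∀ {u} → d ℕ.< toℕ u → toℕ (σinv u) ℕ.≤ d → ∃ λ l → R S l ≡ u
    small-ran d<u u≤d = complete (ranOpen S) (d<u , ≡.trans (inn-agrees C d<u) (upFrom-nothing (s≤s u≤d)))

    dom-small : ∀ j → toℕ (σ (D S j)) ℕ.≤ d
    dom-small j with d<p , e ← sound (domOpen S) j = ℕ.s≤s⁻¹ (upFrom-nothing⁻ (≡.trans (≡.sym (out-agrees C d<p)) e))

    ran-small : ∀ l → toℕ (σinv (R S l)) ℕ.≤ d
    ran-small l with d<p , e ← sound (ranOpen S) l = ℕ.s≤s⁻¹ (upFrom-nothing⁻ (≡.trans (≡.sym (inn-agrees C d<p)) e))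

    σinv-hook : σ i ≢ i → upFrom d (σinv i) ≡ nothing ⊎ ∃ λ j → upFrom d (σinv i) ≡ just (D S j)
    σinv-hook σi≢i with upFrom d (σinv i) in e
    ... | nothing = inj₁ refl
    ... | just q with refl , d≤q ← upFrom-just⁻ {d} {σinv i} e
      with j , e′ ← small-dom (ℕ.≤∧≢⇒< d≤q λ d≡ →
                                σi≢i (≡.subst (λ x → σ x ≡ i) (≡.sym (Fin.toℕ-injective d≡)) (σ-σinv C i)))
                              (ℕ.≤-reflexive (≡.cong toℕ (σ-σinv C i))) = inj₂ (j , ≡.cong just (≡.sym e′))

    fix-hook : σ i ≡ i → Hook i (just i) (just i) v
    fix-hook e = ≡.sym (≡.trans (≡.cong (upFrom d) e) (upFrom-just ℕ.≤-refl))
               , ≡.sym (≡.trans (≡.cong (upFrom d) (σinv≡ C e)) (upFrom-just ℕ.≤-refl))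

    even-hook : isOddᵇ (val i) ≡ false →
                Hook i (just i) (just i) v ⊎ Hook i nothing nothing v ⊎ ∃ λ j → Hook i nothing (just (D S j)) v
    even-hook o with σ i Fin.≟ i
    ... | yes e = inj₁ (fix-hook e)
    ... | no ≢i with e ← upFrom-nothing (ℕ.≤∧≢⇒< (DPerm.even (dperm C) i o) (≢i ∘ Fin.toℕ-injective))
      with σinv-hook ≢i
    ...   | inj₁ e′       = inj₂ (inj₁ (≡.sym e , ≡.sym e′))
    ...   | inj₂ (j , e′) = inj₂ (inj₂ (j , ≡.sym e , ≡.sym e′))

    odd-hook : isOddᵇ (val i) ≡ true →
               Hook i (just i) (just i) v ⊎ (∃ λ l → Hook i (just (R S l)) nothing v)
               ⊎ ∃₂ λ j l → Hook i (just (R S l)) (just (D S j)) v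
    odd-hook o with σ i Fin.≟ i
    ... | yes e = inj₁ (fix-hook e)
    ... | no ≢i with i≤σi ← DPerm.odd (dperm C) i o
      with l , e ← small-ran (ℕ.≤∧≢⇒< i≤σi (≢i ∘ ≡.sym ∘ Fin.toℕ-injective)) (ℕ.≤-reflexive (≡.cong toℕ (σinv-σ C i)))
      with e″ ← ≡.trans (≡.cong just e) (≡.sym (upFrom-just i≤σi)) with σinv-hook ≢i
    ...   | inj₁ e′       = inj₂ (inj₁ (l , e″ , ≡.sym e′))
    ...   | inj₂ (j , e′) = inj₂ (inj₂ (j , l , e″ , ≡.sym e′))

-- Records and cycle minima of an extension

-- Recursive, so that it unfolds together with a sum over `Fin (suc n)`.
isLast : ∀ {n} → Fin (suc n) → Bool
isLast {zero}  zero    = true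
isLast {suc n} zero    = false
isLast {suc n} (suc j) = isLast j

isLast⇒max : ∀ {n} (j : Fin (suc n)) → isLast j ≡ true → (j′ : Fin (suc n)) → j′ ≤ j
isLast⇒max {zero}  zero    _ zero     = z≤n
isLast⇒max {suc n} (suc j) _ zero     = z≤n
isLast⇒max {suc n} (suc j) e (suc j′) = s≤s (isLast⇒max j e j′)

¬isLast⇒< : ∀ {n} (j : Fin (suc n)) → isLast j ≡ false → ∃ λ (j′ : Fin (suc n)) → j < j′
¬isLast⇒< {suc n} zero    _ = suc zero , s≤s z≤n
¬isLast⇒< {suc n} (suc j) e with j′ , j<j′ ← ¬isLast⇒< j e = suc j′ , s≤s j<j′

module _ {M : ℕ} where
  open State
  open Class
  open OpenList

  ≤∧≢ : ∀ {m n : Fin M} → m ≤ n → m ≢ n → m < n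
  ≤∧≢ m≤n m≢n = ℕ.≤∧≢⇒< m≤n (m≢n ∘ Fin.toℕ-injective)

  module _ {d k} (S : State {M} d k) where

    endIndex : ∀ l → ∃ λ j → Path (out S) (R S l) (D S j)
    endIndex l with p , op , path ← pathEnd S (sound (ranOpen S) l)
      with j , refl ← complete (domOpen S) op = j , path

    startIndex : ∀ j → ∃ λ l → Path (out S) (R S l) (D S j)
    startIndex j with u , ou , path ← pathStart S (sound (domOpen S) j)
      with l , refl ← complete (ranOpen S) ou = l , path

    endIndex-startIndex : ∀ {j l} → proj₁ (endIndex l) ≡ j → l ≡ proj₁ (startIndex j)
    endIndex-startIndex {l = l} refl with j , path ← endIndex l with l′ , path′ ← startIndex j =
      elem-injective (ranOpen S) (Path-start-unique S (proj₂ (sound (ranOpen S) l))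
                                                     (proj₂ (sound (ranOpen S) l′)) path path′)

  module _ {k} {i : Fin M} {S : State {M} (suc (toℕ i)) k} {v} (C : Class S v) where

    private
      σ = lookup v
      d = toℕ i
    open Stats σ

    hook-out-just : ∀ {u b} → Hook i (just u) b v → σ i ≡ u × i ≤ u
    hook-out-just (e , _) with refl , d≤ ← upFrom-just⁻ {d = d} (≡.sym e) = refl , d≤

    hook-inn-just : ∀ {a p} → Hook i a (just p) v → σ p ≡ i × i ≤ p
    hook-inn-just (_ , e) with refl , d≤ ← upFrom-just⁻ {d = d} (≡.sym e) = σ-σinv C i , d≤

    hook-out-nothing : ∀ {b} → Hook i nothing b v → σ i < i
    hook-out-nothing (e , _) = upFrom-nothing⁻ (≡.sym e)

    hook-inn-nothing : ∀ {a} → Hook i a nothing v → σinv i < i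
    hook-inn-nothing (_ , e) = upFrom-nothing⁻ (≡.sym e)

    D> : ∀ j → i < D S j
    D> j = proj₁ (sound (domOpen S) j)

    R> : ∀ l → i < R S l
    R> l = proj₁ (sound (ranOpen S) l)

    -- An open value exceeds `i`, hence `σ i`, and it is taken at a position below `i`.
    record-false-open : Fin k → σ i ≤ i → record? i ≡ false
    record-false-open l σi≤i = record-false C (σinv (R S l))
      (≤∧≢ (ran-small C l) λ e → ℕ.<⇒≱ σi<u (ℕ.≤-reflexive (≡.cong toℕ (≡.trans (≡.sym (σ-σinv C _)) (≡.cong σ e)))))
      (ℕ.<-≤-trans σi<u (ℕ.≤-reflexive (≡.cong toℕ (≡.sym (σ-σinv C _)))))
      where σi<u = ℕ.≤-<-trans σi≤i (R> l)

    record-false-peak : σ i < i → σinv i < i → record? i ≡ false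
    record-false-peak σi<i p<i = record-false C (σinv i) p<i
      (ℕ.<-≤-trans σi<i (ℕ.≤-reflexive (≡.cong toℕ (≡.sym (σ-σinv C i)))))

    -- An open position lies above `i`, and its image is at most `i`, hence below `σ i` by
    -- injectivity.
    antirecord-false-open : Fin k → i ≤ σ i → antirecord? i ≡ false
    antirecord-false-open j i≤σi = antirecord-false C (D S j) (D> j)
      (≤∧≢ (ℕ.≤-trans (dom-small C j) i≤σi) λ e → ℕ.<⇒≢ (D> j) (≡.cong toℕ (≡.sym (DPerm.injective (dperm C) e))))

    -- There are as many open values as open positions. The preimage of an open value lies to the
    -- left of `D S j`, and its image is larger than `i`.
    record-D : Fin k → ∀ {j} → σ (D S j) ≡ i → record? (D S j) ≡ false
    record-D l {j} e = record-false C (σinv (R S l)) (ℕ.≤-<-trans (ran-small C l) (D> j))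
      (≡.subst₂ _<_ (≡.sym e) (≡.sym (σ-σinv C _)) (R> l))

  module _ {i : Fin M} {S : State {M} (suc (toℕ i)) 0} {v} (C : Class S v) where

    private σ = lookup v
    open Stats σ

    -- With nothing open, the points above `i` are permuted among themselves, so no earlier position
    -- has an image beyond the fixed value.
    record-closed : σ i ≡ i → record? i ≡ true
    record-closed σi≡i = record-true C λ q q<i → ℕ.≰⇒> λ σi≤σq →
      Fin.¬Fin0 (proj₁ (small-ran C
        (≤∧≢ (≡.subst (_≤ σ q) σi≡i σi≤σq)
             λ e → ℕ.<⇒≢ q<i (≡.cong toℕ (DPerm.injective (dperm C) (≡.trans (≡.sym e) (≡.sym σi≡i)))))
        (ℕ.≤-trans (ℕ.≤-reflexive (≡.cong toℕ (σinv-σ C q))) (ℕ.<⇒≤ q<i))))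

    antirecord-closed : σ i ≡ i → antirecord? i ≡ true
    antirecord-closed σi≡i = antirecord-true C λ q i<q → ℕ.≰⇒> λ σq≤σi →
      Fin.¬Fin0 (proj₁ (small-dom C i<q (≡.subst (σ q ≤_) σi≡i σq≤σi)))

  module _ {k} {i : Fin M} {S : State {M} (suc (toℕ i)) (suc k)} {v} (C : Class S v) where

    private
      σ = lookup v
      d = toℕ i
      injective = DPerm.injective (dperm C)
    open Stats σ

    -- Only another open position to the right of `D S j` can have an image below `i`, and every
    -- other open position does have one.
    antirecord-D : ∀ {j} → σ (D S j) ≡ i → antirecord? (D S j) ≡ isLast j
    antirecord-D {j} e with isLast j in last
    ... | true = antirecord-true C λ q D<q → ℕ.≰⇒> λ σq≤ → beyond q D<q (≡.subst (σ q ≤_) e σq≤)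
      where
      beyond : ∀ q → D S j < q → σ q ≤ i → ⊥
      beyond q D<q σq≤i with j′ , refl ← small-dom C (ℕ.<-trans (D> C j) D<q) σq≤i =
        ℕ.<⇒≱ D<q (elem-mono (domOpen S) (isLast⇒max j last j′))
    ... | false with j′ , j<j′ ← ¬isLast⇒< j last = antirecord-false C (D S j′) (sorted (domOpen S) j<j′)
      (≡.subst (σ (D S j′) <_) (≡.sym e) (≤∧≢ (dom-small C j′)
        λ e′ → ℕ.<⇒≢ (sorted (domOpen S) j<j′) (≡.cong toℕ (injective (≡.trans e (≡.sym e′))))))

    -- Dual to `antirecord-D`: an image above `R S l` attained before `i` is itself an open value.
    record-R : ∀ {l} → σ i ≡ R S l → record? i ≡ isLast l
    record-R {l} e with isLast l in last
    ... | true = record-true C λ q q<i → ℕ.≰⇒> λ ≤σq →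
      beyond q q<i (≤∧≢ (≡.subst (_≤ σ q) e ≤σq) λ e′ →
        ℕ.<⇒≢ q<i (≡.cong toℕ (injective (≡.trans (≡.sym e′) (≡.sym e)))))
      where
      beyond : ∀ q → q < i → R S l < σ q → ⊥
      beyond q q<i R<σq with l′ , e′ ← small-ran C (ℕ.<-trans (R> C l) R<σq)
                                          (ℕ.≤-trans (ℕ.≤-reflexive (≡.cong toℕ (σinv-σ C q))) (ℕ.<⇒≤ q<i)) =
        ℕ.<⇒≱ (≡.subst (R S l <_) (≡.sym e′) R<σq) (elem-mono (ranOpen S) (isLast⇒max l last l′))
    ... | false with l′ , l<l′ ← ¬isLast⇒< l last = record-false C (σinv (R S l′))
      (≤∧≢ (ran-small C l′) λ e′ →
        ℕ.<⇒≢ R<R′ (≡.cong toℕ (≡.trans (≡.sym e) (≡.trans (≡.cong σ (≡.sym e′)) (σ-σinv C _)))))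
      (≡.subst₂ _<_ (≡.sym e) (≡.sym (σ-σinv C _)) R<R′)
      where R<R′ = sorted (ranOpen S) l<l′

  module _ {k} {i : Fin M} {S : State {M} (suc (toℕ i)) k} {v} (C : Class S v) {j l}
           (D→i : lookup v (D S j) ≡ i) (i→R : lookup v i ≡ R S l) where

    private σ = lookup v
    open Stats σ

    out-σ : ∀ {x y} → i < x → out S x ≡ just y → σ x ≡ y × i < y
    out-σ i<x e with refl , i<y ← upFrom-just⁻ (≡.trans (≡.sym (out-agrees C i<x)) e) = refl , i<y

    -- The orbit of `i` runs along the path and returns to `i`, and all points of the path are
    -- larger.
    cycmin-closing : Path (out S) (R S l) (D S j) → cycmin i ≡ true
    cycmin-closing path = cycmin-true C (above ∘ onCycle)
      where
      OnCycle : Fin M → Set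
      OnCycle x = x ≡ i ⊎ (i < x × Path (out S) x (D S j))
      above : ∀ {x} → OnCycle x → i ≤ x
      above (inj₁ refl)      = ℕ.≤-refl
      above (inj₂ (i<x , _)) = ℕ.<⇒≤ i<x
      next : ∀ {x} → OnCycle x → OnCycle (σ x)
      next (inj₁ refl)             =
        inj₂ (≡.subst (λ x → i < x × Path (out S) x (D S j)) (≡.sym i→R) (R> C l , path))
      next (inj₂ (i<x , []))       = inj₁ D→i
      next (inj₂ (i<x , (e ∷ p))) with refl , i<y ← out-σ i<x e = inj₂ (i<y , p)
      onCycle : ∀ t → OnCycle (iter t i)
      onCycle zero    = inj₁ refl
      onCycle (suc t) = next (onCycle t)

    follow : ∀ {x y} t → iter t i ≡ x → i < x → Path (out S) x y → ∃ λ t → iter t i ≡ y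
    follow t e i<x []      = t , e
    follow t refl i<x (e ∷ p) with refl , i<y ← out-σ i<x e = follow (suc t) refl i<y p

    -- The orbit of `i` reaches an open position other than the preimage of `i`, and from there it
    -- drops strictly below `i`.
    cycmin-open : ∀ {j′} → j ≢ j′ → Path (out S) (R S l) (D S j′) → cycmin i ≡ false
    cycmin-open {j′} j≢j′ path with t , e ← follow 1 i→R (R> C l) path =
      cycmin-false C (suc t) (≡.subst (λ x → σ x < i) (≡.sym e)
        (≤∧≢ (dom-small C j′) λ e′ →
          j≢j′ (elem-injective (domOpen S) (DPerm.injective (dperm C) (≡.trans D→i (≡.sym e′))))))

    -- For each value there is one closing position; `cycmin-start` is the converse form. The first
    -- serves to sum over `j` with `l` fixed, the second to sum over `l` with `j` fixed.
    cycmin-end : cycmin i ≡ does (j Fin.≟ proj₁ (endIndex S l))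
    cycmin-end with endIndex S l
    ... | j′ , path with j Fin.≟ j′
    ...   | yes refl = cycmin-closing path
    ...   | no j≢j′  = cycmin-open j≢j′ path

    cycmin-start : cycmin i ≡ does (l Fin.≟ proj₁ (startIndex S j))
    cycmin-start with l Fin.≟ proj₁ (startIndex S j)
    ... | yes refl = cycmin-closing (proj₂ (startIndex S j))
    ... | no l≢l′  = cycmin-open (λ e → l≢l′ (endIndex-startIndex S (≡.sym e))) (proj₂ (endIndex S l))

-- Local flags, labels of open points, and parity along the moves

<ᵇ-flip : ∀ {m n} → m ≢ n → (m <ᵇ n) ≡ not (n <ᵇ m)
<ᵇ-flip {m} {n} m≢n with ℕ.<-cmp m n
... | tri< m<n _ _ rewrite <ᵇ-true m<n | <ᵇ-false (ℕ.<⇒≤ m<n) = refl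
... | tri≈ _ m≡n _ = contradiction m≡n m≢n
... | tri> _ _ n<m rewrite <ᵇ-true n<m | <ᵇ-false (ℕ.<⇒≤ n<m) = refl

-- All tests on which the factor at `i` depends, so that evaluating it becomes a finite case split.
-- The prefixes `p` and `q` refer to the preimage and the image of `i`; for instance `pim<` says
-- that the image of `p` is below `p`.
record Flags : Set where
  constructor flags
  field
    inv< im< <inv <im fix rec arec cyc ev od : Bool
    pinv< pim< p<inv prec parec : Bool
    qinv< qim< q<im : Bool

module _ {m} (σ : Fin m → Fin m) where
  open Stats σ

  flagsAt : Fin m → Flags
  flagsAt i = flags
    (toℕ p <ᵇ toℕ i) (toℕ q <ᵇ toℕ i) (toℕ i <ᵇ toℕ p) (toℕ i <ᵇ toℕ q)
    (fixed i) (record? i) (antirecord? i) (cycmin i) (isEvenᵇ (val i)) (isOddᵇ (val i))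
    (toℕ (σinv p) <ᵇ toℕ p) (toℕ (σ p) <ᵇ toℕ p) (toℕ p <ᵇ toℕ (σinv p)) (record? p) (antirecord? p)
    (toℕ (σinv q) <ᵇ toℕ q) (toℕ (σ q) <ᵇ toℕ q) (toℕ q <ᵇ toℕ (σ q))
    where
    p = σinv i
    q = σ i

module _ {M : ℕ} where
  open State
  open Class
  open OpenList

  -- An open position has its image below the threshold, so comparing it with its preimage tells a
  -- double fall (`true`) from a peak. For an open value the comparison with its image tells a
  -- double rise from a peak. The preimage or image may still be unknown, hence the quantification
  -- over all completions.
  DLabels RLabels : ∀ {d k} → State {M} d k → (Fin k → Bool) → Set
  DLabels S w = ∀ {v} → Class S v → ∀ j → w j ≡ (toℕ (D S j) <ᵇ toℕ (Stats.σinv (lookup v) (D S j)))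
  RLabels S w = ∀ {v} → Class S v → ∀ l → w l ≡ (toℕ (R S l) <ᵇ toℕ (lookup v (R S l)))

  module _ {k} {i : Fin M} {S : State {M} (suc (toℕ i)) k} {v} (C : Class S v) where

    private σ = lookup v
    open Stats σ
    open Flags (flagsAt σ i)

    module PeakFlags (h : Hook i nothing nothing v) where
      σi<i = hook-out-nothing C h
      p<i = hook-inn-nothing C h

      inv<≡ : inv< ≡ true
      inv<≡ = <ᵇ-true p<i
      <inv≡ : <inv ≡ false
      <inv≡ = <ᵇ-false (ℕ.<⇒≤ p<i)
      <im≡ : <im ≡ false
      <im≡ = <ᵇ-false (ℕ.<⇒≤ σi<i)
      fix≡ : fix ≡ false
      fix≡ = ≡ᵇ-false (ℕ.<⇒≢ σi<i)
      rec≡ : rec ≡ false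
      rec≡ = record-false-peak C σi<i p<i
      pim<≡ : pim< ≡ false
      pim<≡ = <ᵇ-false (≡.subst (σinv i ≤_) (≡.sym (σ-σinv C i)) (ℕ.<⇒≤ p<i))
      qinv<≡ : qinv< ≡ false
      qinv<≡ = <ᵇ-false (≡.subst (σ i ≤_) (≡.sym (σinv-σ C i)) (ℕ.<⇒≤ σi<i))

    module FixFlags (h : Hook i (just i) (just i) v) where
      σi≡i = proj₁ (hook-out-just C h)
      p≡i : σinv i ≡ i
      p≡i = σinv≡ C σi≡i

      inv<≡ : inv< ≡ false
      inv<≡ = <ᵇ-false (ℕ.≤-reflexive (≡.cong toℕ (≡.sym p≡i)))
      <inv≡ : <inv ≡ false
      <inv≡ = <ᵇ-false (ℕ.≤-reflexive (≡.cong toℕ p≡i))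
      fix≡ : fix ≡ true
      fix≡ = ≡ᵇ-true (≡.cong toℕ σi≡i)
      pim<≡ : pim< ≡ false
      pim<≡ = <ᵇ-false (ℕ.≤-reflexive (≡.cong toℕ (≡.trans p≡i (≡.sym (σ-σinv C i)))))
      qinv<≡ : qinv< ≡ false
      qinv<≡ = <ᵇ-false (ℕ.≤-reflexive (≡.cong toℕ (≡.trans σi≡i (≡.sym (σinv-σ C i)))))

    module FromD {j a} (h : Hook i a (just (D S j)) v) where
      D→i = proj₁ (hook-inn-just C h)
      p≡D : σinv i ≡ D S j
      p≡D = σinv≡ C D→i
      i<p : i < σinv i
      i<p = ≡.subst (i <_) (≡.sym p≡D) (D> C j)

      inv<≡ : inv< ≡ false
      inv<≡ = <ᵇ-false (ℕ.<⇒≤ i<p)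
      <inv≡ : <inv ≡ true
      <inv≡ = <ᵇ-true i<p
      pim<≡ : pim< ≡ true
      pim<≡ = <ᵇ-true (≡.subst (_< σinv i) (≡.sym (σ-σinv C i)) i<p)
      prec≡ : prec ≡ false
      prec≡ = ≡.trans (≡.cong record? p≡D) (record-D C (proj₁ (startIndex S j)) D→i)

      module Label {w} (lab : DLabels S w) where
        p<inv≡ : p<inv ≡ w j
        p<inv≡ = ≡.trans (≡.cong (λ x → toℕ x <ᵇ toℕ (σinv x)) p≡D) (≡.sym (lab C j))
        pinv<≡ : pinv< ≡ not (w j)
        pinv<≡ = ≡.trans (<ᵇ-flip (moved ∘ Fin.toℕ-injective)) (≡.cong not p<inv≡)
          where
          moved : σinv (σinv i) ≢ σinv i
          moved e = ℕ.<⇒≢ i<p (≡.cong toℕ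
            (≡.trans (≡.sym (σ-σinv C i)) (≡.trans (≡.cong σ (≡.sym e)) (σ-σinv C (σinv i)))))

    module ToR {l b} (h : Hook i (just (R S l)) b v) where
      i→R = proj₁ (hook-out-just C h)
      i<σi : i < σ i
      i<σi = ≡.subst (i <_) (≡.sym i→R) (R> C l)

      im<≡ : im< ≡ false
      im<≡ = <ᵇ-false (ℕ.<⇒≤ i<σi)
      <im≡ : <im ≡ true
      <im≡ = <ᵇ-true i<σi
      fix≡ : fix ≡ false
      fix≡ = ≡ᵇ-false (ℕ.<⇒≢ i<σi ∘ ≡.sym)
      arec≡ : arec ≡ false
      arec≡ = antirecord-false-open C (proj₁ (endIndex S l)) (ℕ.<⇒≤ i<σi)
      qinv<≡ : qinv< ≡ true
      qinv<≡ = <ᵇ-true (≡.subst (_< σ i) (≡.sym (σinv-σ C i)) i<σi)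

      module Label {w} (lab : RLabels S w) where
        q<im≡ : q<im ≡ w l
        q<im≡ = ≡.trans (≡.cong (λ x → toℕ x <ᵇ toℕ (σ x)) i→R) (≡.sym (lab C l))
        qim<≡ : qim< ≡ not (w l)
        qim<≡ = ≡.trans
          (<ᵇ-flip λ e → ℕ.<⇒≢ i<σi (≡.cong toℕ (≡.sym (DPerm.injective (dperm C) (Fin.toℕ-injective e)))))
          (≡.cong not q<im≡)

    module DFallFlags {j} (h : Hook i nothing (just (D S j)) v) where
      open FromD h public
      σi<i = hook-out-nothing C h

      im<≡ : im< ≡ true
      im<≡ = <ᵇ-true σi<i
      <im≡ : <im ≡ false
      <im≡ = <ᵇ-false (ℕ.<⇒≤ σi<i)
      fix≡ : fix ≡ false
      fix≡ = ≡ᵇ-false (ℕ.<⇒≢ σi<i)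
      rec≡ : rec ≡ false
      rec≡ = record-false-open C (proj₁ (startIndex S j)) (ℕ.<⇒≤ σi<i)
      qinv<≡ : qinv< ≡ false
      qinv<≡ = <ᵇ-false (≡.subst (σ i ≤_) (≡.sym (σinv-σ C i)) (ℕ.<⇒≤ σi<i))

    module DRiseFlags {l} (h : Hook i (just (R S l)) nothing v) where
      open ToR h public
      p<i = hook-inn-nothing C h

      inv<≡ : inv< ≡ true
      inv<≡ = <ᵇ-true p<i
      <inv≡ : <inv ≡ false
      <inv≡ = <ᵇ-false (ℕ.<⇒≤ p<i)
      pim<≡ : pim< ≡ false
      pim<≡ = <ᵇ-false (≡.subst (σinv i ≤_) (≡.sym (σ-σinv C i)) (ℕ.<⇒≤ p<i))

  module _ {k} {i : Fin M} {S : State {M} (suc (toℕ i)) k} where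

    private d = toℕ i

    labels-peakᴰ : ∀ {w} → DLabels S w → DLabels (peakState i refl S) (false Vector.∷ w)
    labels-peakᴰ lab C′ j with C , h ← restrictClass (peakExtends i refl S) C′ with j
    ... | zero  = ≡.sym (PeakFlags.<inv≡ C h)
    ... | suc j = lab C j

    labels-peakᴿ : ∀ {w} → RLabels S w → RLabels (peakState i refl S) (false Vector.∷ w)
    labels-peakᴿ lab C′ j with C , h ← restrictClass (peakExtends i refl S) C′ with j
    ... | zero  = ≡.sym (PeakFlags.<im≡ C h)
    ... | suc j = lab C j

    labels-fixᴰ : ∀ {w} → DLabels S w → DLabels (fixState i refl S) w
    labels-fixᴰ lab = lab ∘ proj₁ ∘ restrictClass (fixExtends i refl S)

    labels-fixᴿ : ∀ {w} → RLabels S w → RLabels (fixState i refl S) w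
    labels-fixᴿ lab = lab ∘ proj₁ ∘ restrictClass (fixExtends i refl S)

  module _ {k} {i : Fin M} {S : State {M} (suc (toℕ i)) (suc k)} where

    labels-dfallᴰ : ∀ {w} → DLabels S w → ∀ j → DLabels (dfallState i refl S j) (true Vector.∷ w ∘ punchIn j)
    labels-dfallᴰ lab j C′ x with C , h ← restrictClass (dfallExtends i refl S j) C′ with x
    ... | zero  = ≡.sym (FromD.<inv≡ C h)
    ... | suc x = lab C (punchIn j x)

    labels-dfallᴿ : ∀ {w} → RLabels S w → ∀ j → RLabels (dfallState i refl S j) w
    labels-dfallᴿ lab j = lab ∘ proj₁ ∘ restrictClass (dfallExtends i refl S j)

    labels-driseᴰ : ∀ {w} → DLabels S w → ∀ l → DLabels (driseState i refl S l) w
    labels-driseᴰ lab l = lab ∘ proj₁ ∘ restrictClass (driseExtends i refl S l)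

    labels-driseᴿ : ∀ {w} → RLabels S w → ∀ l → RLabels (driseState i refl S l) (true Vector.∷ w ∘ punchIn l)
    labels-driseᴿ lab l C′ x with C , h ← restrictClass (driseExtends i refl S l) C′ with x
    ... | zero  = ≡.sym (ToR.<im≡ C h)
    ... | suc x = lab C (punchIn l x)

    labels-valleyᴰ : ∀ {w} → DLabels S w → ∀ j l → DLabels (valleyState i refl S j l) (w ∘ punchIn j)
    labels-valleyᴰ lab j l C′ x = lab (proj₁ (restrictClass (valleyExtends i refl S j l) C′)) (punchIn j x)

    labels-valleyᴿ : ∀ {w} → RLabels S w → ∀ j l → RLabels (valleyState i refl S j l) (w ∘ punchIn l)
    labels-valleyᴿ lab j l C′ x = lab (proj₁ (restrictClass (valleyExtends i refl S j l) C′)) (punchIn l x)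

  module _ {k} {i : Fin M} {S : State {M} (suc (toℕ i)) k} (P : Parity S) where

    parity-fix : Parity (fixState i refl S)
    parity-fix = extendParity (fixExtends i refl S) P (λ _ → i , refl , ℕ.≤-refl) (λ { _ refl → ℕ.≤-refl })

    parity-peak : isOddᵇ (val i) ≡ false → Parity (peakState i refl S)
    parity-peak even = extendParity (peakExtends i refl S) P
      (λ odd → contradiction (≡.trans (≡.sym even) odd) λ ()) (λ _ ())

  module _ {k} {i : Fin M} {S : State {M} (suc (toℕ i)) (suc k)} (P : Parity S) where

    parity-dfall : isOddᵇ (val i) ≡ false → ∀ j → Parity (dfallState i refl S j)
    parity-dfall even j = extendParity (dfallExtends i refl S j) P
      (λ odd → contradiction (≡.trans (≡.sym even) odd) λ ()) (λ _ ())

    parity-drise : isOddᵇ (val i) ≡ true → ∀ l → Parity (driseState i refl S l)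
    parity-drise odd l = extendParity (driseExtends i refl S l) P
      (λ _ → _ , refl , ℕ.<⇒≤ (proj₁ (sound (ranOpen S) l)))
      (λ even → contradiction (≡.trans (≡.sym even) odd) λ ())

    parity-valley : isOddᵇ (val i) ≡ true → ∀ j l → Parity (valleyState i refl S j l)
    parity-valley odd j l = extendParity (valleyExtends i refl S j l) P
      (λ _ → _ , refl , ℕ.<⇒≤ (proj₁ (sound (ranOpen S) l)))
      (λ even → contradiction (≡.trans (≡.sym even) odd) λ ())

-- Enumeration of the D-permutations

allVecs-product : ∀ {m} k → allVecs {m} (suc k) ≡ cartesianProductWith Vec._∷_ (allFin m) (allVecs k)
allVecs-product {m} k = go (allFin m)
  where
  go : ∀ as → concatMap (λ a → map (a Vec.∷_) (allVecs k)) as ≡ cartesianProductWith Vec._∷_ as (allVecs k)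
  go []       = refl
  go (a ∷ as) = ≡.cong (map (a Vec.∷_) (allVecs k) ++_) (go as)

allVecs-complete : ∀ {m k} (v : Vec (Fin m) k) → v ∈ allVecs k
allVecs-complete Vec.[] = here refl
allVecs-complete {k = suc k} (a Vec.∷ v) = ≡.subst (a Vec.∷ v ∈_) (≡.sym (allVecs-product k))
  (∈-cartesianProductWith⁺ Vec._∷_ (∈-allFin a) (allVecs-complete v))

allVecs-unique : ∀ {m} k → Unique (allVecs {m} k)
allVecs-unique zero = [] ∷ []
allVecs-unique {m} (suc k) = ≡.subst Unique (≡.sym (allVecs-product k))
  (cartesianProductWith⁺ Vec._∷_ Vec.∷-injective (allFin⁺ m) (allVecs-unique k))

filterᵇ-map : ∀ {A B : Set} (f : A → B) (p : B → Bool) xs → filterᵇ p (map f xs) ≡ map f (filterᵇ (p ∘ f) xs)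
filterᵇ-map f p [] = refl
filterᵇ-map f p (x ∷ xs) with p (f x)
... | true  = ≡.cong (f x ∷_) (filterᵇ-map f p xs)
... | false = filterᵇ-map f p xs

module Evaluation {c ℓ} (R : CommutativeRing c ℓ)
  (x₁ x₂ ỹ₁ y₂ u₁ u₂ ṽ₁ v₂ wₑ wₒ zₑ zₒ : CommutativeRing.Carrier R) where

  open CommutativeRing R hiding (zero) renaming (refl to ≈-refl)
  open Poly R x₁ x₂ ỹ₁ y₂ u₁ u₂ ṽ₁ v₂ wₑ wₒ zₑ zₒ
  open import Algebra.Solver.Ring.NaturalCoefficients.Default commutativeSemiring
    using (solve; _:=_; _:+_; _:*_; con)
  open import Algebra.Properties.Semiring.Sum semiring
    using (sum; sum-cong-≋; *-distribʳ-sum; ∑-comm)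
  open import Algebra.Properties.CommutativeMonoid.Sum *-commutativeMonoid
    using () renaming (sum to prod; sum-cong-≋ to prod-cong; sum-replicate-zero to prod-replicate-one;
                       sum-remove to prod-remove; sum-permute to prod-permute; ∑-distrib-+ to prod-distrib-*)
  open import Relation.Binary.Reasoning.Setoid setoid

  -- The T-fraction

  sumTo-cong : ∀ n {f g : ℕ → Carrier} → (∀ i → i ℕ.≤ n → f i ≈ g i) → sumTo n f ≈ sumTo n g
  sumTo-cong zero    e = e 0 z≤n
  sumTo-cong (suc n) e = +-cong (sumTo-cong n λ i i≤n → e i (ℕ.m≤n⇒m≤1+n i≤n)) (e (suc n) ℕ.≤-refl)

  sumTo-+ : ∀ n f g → sumTo n (λ i → f i + g i) ≈ sumTo n f + sumTo n g
  sumTo-+ zero    f g = ≈-refl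
  sumTo-+ (suc n) f g = trans (+-congʳ (sumTo-+ n f g))
    (solve 4 (λ a b c d → (a :+ b) :+ (c :+ d) := (a :+ c) :+ (b :+ d)) ≈-refl _ _ _ _)

  sumTo-* : ∀ n a f → sumTo n (λ i → a * f i) ≈ a * sumTo n f
  sumTo-* zero    a f = ≈-refl
  sumTo-* (suc n) a f = trans (+-congʳ (sumTo-* n a f)) (sym (distribˡ a _ _))

  sumTo-first : ∀ n f → sumTo (suc n) f ≈ f 0 + sumTo n (f ∘ suc)
  sumTo-first zero    f = ≈-refl
  sumTo-first (suc n) f = trans (+-congʳ (sumTo-first n f)) (+-assoc _ _ _)

  mulS-cong : ∀ n {f f′ g g′ : PS} → (∀ i → i ℕ.≤ n → f i ≈ f′ i) → (∀ i → i ℕ.≤ n → g i ≈ g′ i) →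
              mulS f g n ≈ mulS f′ g′ n
  mulS-cong n e e′ = sumTo-cong n λ i i≤n → *-cong (e i i≤n) (e′ (n ∸ i) (ℕ.m∸n≤m n i))

  mulS-congˡ : ∀ h n {f f′ : PS} → (∀ i → f i ≈ f′ i) → mulS f h n ≈ mulS f′ h n
  mulS-congˡ h n e = mulS-cong n {g = h} (λ i _ → e i) (λ _ _ → ≈-refl)

  mulS-suc : ∀ f g n → mulS f g (suc n) ≈ f 0 * g (suc n) + mulS (f ∘ suc) g n
  mulS-suc f g n = sumTo-first n _

  mulS-+ˡ : ∀ f g h n → mulS (λ i → f i + g i) h n ≈ mulS f h n + mulS g h n
  mulS-+ˡ f g h n = trans (sumTo-cong n λ i _ → distribʳ (h (n ∸ i)) (f i) (g i)) (sumTo-+ n _ _)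

  mulS-*ˡ : ∀ a f h n → mulS (λ i → a * f i) h n ≈ a * mulS f h n
  mulS-*ˡ a f h n = trans (sumTo-cong n λ i _ → *-assoc a (f i) (h (n ∸ i))) (sumTo-* n a _)

  mulS-assoc : ∀ f g h n → mulS (mulS f g) h n ≈ mulS f (mulS g h) n
  mulS-assoc f g h zero    = *-assoc _ _ _
  mulS-assoc f g h (suc n) = begin
    mulS (mulS f g) h (suc n)
      ≈⟨ mulS-suc (mulS f g) h n ⟩
    f 0 * g 0 * h (suc n) + mulS (mulS f g ∘ suc) h n
      ≈⟨ +-congˡ (mulS-congˡ h n (mulS-suc f g)) ⟩
    f 0 * g 0 * h (suc n) + mulS (λ i → f 0 * g (suc i) + mulS (f ∘ suc) g i) h n
      ≈⟨ +-congˡ (mulS-+ˡ _ _ h n) ⟩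
    f 0 * g 0 * h (suc n) + (mulS (λ i → f 0 * g (suc i)) h n + mulS (mulS (f ∘ suc) g) h n)
      ≈⟨ +-congˡ (+-cong (mulS-*ˡ _ _ h n) (mulS-assoc (f ∘ suc) g h n)) ⟩
    f 0 * g 0 * h (suc n) + (f 0 * mulS (g ∘ suc) h n + mulS (f ∘ suc) (mulS g h) n)
      ≈⟨ solve 5 (λ a b c d e → a :* b :* c :+ (a :* d :+ e) := a :* (b :* c :+ d) :+ e) ≈-refl _ _ _ _ _ ⟩
    f 0 * (g 0 * h (suc n) + mulS (g ∘ suc) h n) + mulS (f ∘ suc) (mulS g h) n
      ≈⟨ +-congʳ (*-congˡ (mulS-suc g h n)) ⟨
    f 0 * mulS g h (suc n) + mulS (f ∘ suc) (mulS g h) n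
      ≈⟨ mulS-suc f (mulS g h) n ⟨
    mulS f (mulS g h) (suc n) ∎

  -- Σₖ tᵏ Gₖ
  tsum : (ℕ → PS) → PS
  tsum G n = sumTo n (λ k → G k (n ∸ k))

  -- Peeling the constant coefficient off `g` lowers `n`. The summand `k = n + 1` contributes only
  -- its constant term and is split off for that reason.
  mulS-tsum : ∀ g G n → mulS g (tsum G) n ≈ tsum (λ k → mulS g (G k)) n
  mulS-tsum g G zero    = ≈-refl
  mulS-tsum g G (suc n) = begin
    mulS g (tsum G) (suc n)
      ≈⟨ mulS-suc g (tsum G) n ⟩
    g 0 * (sumTo n (λ k → G k (suc n ∸ k)) + G (suc n) (n ∸ n)) + mulS (g ∘ suc) (tsum G) n
      ≈⟨ +-congˡ (mulS-tsum (g ∘ suc) G n) ⟩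
    g 0 * (sumTo n (λ k → G k (suc n ∸ k)) + G (suc n) (n ∸ n)) + tsum (λ k → mulS (g ∘ suc) (G k)) n
      ≈⟨ solve 4 (λ a b c d → a :* (b :+ c) :+ d := (a :* b :+ d) :+ a :* c) ≈-refl _ _ _ _ ⟩
    (g 0 * sumTo n (λ k → G k (suc n ∸ k)) + tsum (λ k → mulS (g ∘ suc) (G k)) n) + g 0 * G (suc n) (n ∸ n)
      ≈⟨ +-congʳ (trans (+-congʳ (sym (sumTo-* n _ _))) (sym (sumTo-+ n _ _))) ⟩
    sumTo n (λ k → g 0 * G k (suc n ∸ k) + mulS (g ∘ suc) (G k) (n ∸ k)) + g 0 * G (suc n) (n ∸ n)
      ≈⟨ +-cong (sumTo-cong n step) (reflexive (≡.cong (λ m → g 0 * G (suc n) m) (ℕ.n∸n≡0 n))) ⟩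
    sumTo n (λ k → mulS g (G k) (suc n ∸ k)) + g 0 * G (suc n) 0
      ≈⟨ +-congˡ (reflexive (≡.cong (mulS g (G (suc n))) (≡.sym (ℕ.n∸n≡0 n)))) ⟩
    tsum (λ k → mulS g (G k)) (suc n) ∎
    where
    step : ∀ k → k ℕ.≤ n → g 0 * G k (suc n ∸ k) + mulS (g ∘ suc) (G k) (n ∸ k) ≈ mulS g (G k) (suc n ∸ k)
    step k k≤n rewrite ℕ.+-∸-assoc 1 k≤n = sym (mulS-suc g (G k) (n ∸ k))

  -- The coefficients of `f = 1 + t g f` for `f = 1 / (1 - t g)`; all later facts about the fraction
  -- come from this equation.
  inv1-t·-suc : ∀ g n → inv1-t· g (suc n) ≈ mulS g (inv1-t· g) n
  inv1-t·-suc g n = begin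
    inv1-t· g (suc n)               ≈⟨ sumTo-first n _ ⟩
    0# + tsum (powS g ∘ suc) n      ≈⟨ +-identityˡ _ ⟩
    tsum (λ k → mulS g (powS g k)) n ≈⟨ mulS-tsum g (powS g) n ⟨
    mulS g (inv1-t· g) n            ∎

  conv-zero : ∀ N k → conv N k 0 ≈ 1#
  conv-zero zero    k = ≈-refl
  conv-zero (suc N) k = ≈-refl

  conv-stable : ∀ n N k → n ℕ.≤ N → conv N k n ≈ conv n k n
  conv-stable n = go n n ℕ.≤-refl
    where
    go : ∀ b n → n ℕ.≤ b → ∀ N k → n ℕ.≤ N → conv N k n ≈ conv n k n
    go b       zero    _         N       k _ = conv-zero N k
    go (suc b) (suc n) (s≤s n≤b) (suc N) k (s≤s n≤N) = begin
      conv (suc N) k (suc n)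
        ≈⟨ inv1-t·-suc _ n ⟩
      mulS (λ i → (if i ≡ᵇ 0 then δ k else 0#) + α k * conv N (suc k) i) (conv (suc N) k) n
        ≈⟨ mulS-cong n
             (λ i i≤n → +-congˡ (*-congˡ (compare i (ℕ.≤-trans i≤n n≤N) i≤n (ℕ.≤-trans i≤n n≤b) (suc k))))
             (λ i i≤n → compare i (ℕ.≤-trans i≤n (ℕ.m≤n⇒m≤1+n n≤N)) (ℕ.m≤n⇒m≤1+n i≤n) (ℕ.≤-trans i≤n n≤b) k) ⟩
      mulS (λ i → (if i ≡ᵇ 0 then δ k else 0#) + α k * conv n (suc k) i) (conv (suc n) k) n
        ≈⟨ inv1-t·-suc _ n ⟨
      conv (suc n) k (suc n) ∎
      where
      compare : ∀ i {N N′} → i ℕ.≤ N → i ℕ.≤ N′ → i ℕ.≤ b → ∀ k → conv N k i ≈ conv N′ k i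
      compare i i≤N i≤N′ i≤b k = trans (go b i i≤b _ k i≤N) (sym (go b i i≤b _ k i≤N′))

  -- F k is the continued fraction starting at level k, so
  -- F k = 1 / (1 - δₖ t - αₖ t F (k + 1)).
  F : ℕ → PS
  F k n = conv n k n

  F-suc : ∀ k n → F k (suc n) ≈ mulS (λ i → (if i ≡ᵇ 0 then δ k else 0#) + α k * F (suc k) i) (F k) n
  F-suc k n = trans (inv1-t·-suc _ n)
    (mulS-cong n (λ i i≤n → +-congˡ (*-congˡ (conv-stable i n (suc k) i≤n)))
                 (λ i i≤n → conv-stable i (suc n) k (ℕ.m≤n⇒m≤1+n i≤n)))

  -- ΠF h = F 1 * F 2 * ... * F (h + 1)
  ΠF : ℕ → PS
  ΠF zero    = F 1
  ΠF (suc h) = mulS (F (suc (suc h))) (ΠF h)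

  ΠF-zero : ∀ h → ΠF h 0 ≈ 1#
  ΠF-zero zero    = ≈-refl
  ΠF-zero (suc h) = trans (*-identityˡ _) (ΠF-zero h)

  mulS-const : ∀ a f n → mulS (λ i → if i ≡ᵇ 0 then a else 0#) f n ≈ a * f n
  mulS-const a f zero    = ≈-refl
  mulS-const a f (suc n) = trans (mulS-suc _ f n)
    (trans (+-congˡ (trans (sumTo-cong n λ i _ → trans (zeroˡ _) (sym (zeroˡ 0#)))
                           (trans (sumTo-* n 0# _) (zeroˡ _)))) (+-identityʳ _))

  mulS-fraction : ∀ k f n → mulS (λ i → (if i ≡ᵇ 0 then δ k else 0#) + α k * F (suc k) i) f n
                          ≈ δ k * f n + α k * mulS (F (suc k)) f n
  mulS-fraction k f n = trans (mulS-+ˡ _ _ f n) (+-cong (mulS-const (δ k) f n) (mulS-*ˡ (α k) _ f n))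

  ΠF₀-suc : ∀ n → ΠF 0 (suc n) ≈ zₑ * zₒ * ΠF 0 n + α 1 * ΠF 1 n
  ΠF₀-suc n = trans (F-suc 1 n) (mulS-fraction 1 (F 1) n)

  -- Multiply `F = 1 + t α F⁺ F` by the product of the lower tails, where `F⁺` is the next tail; `δ`
  -- vanishes above the first level. In terms of paths, one starting at height `h + 1` steps down or
  -- up.
  ΠF-suc : ∀ h n → ΠF (suc h) (suc n) ≈ ΠF h (suc n) + α (suc (suc h)) * ΠF (suc (suc h)) n
  ΠF-suc h n = begin
    mulS f (ΠF h) (suc n)
      ≈⟨ mulS-suc f (ΠF h) n ⟩
    1# * ΠF h (suc n) + mulS (f ∘ suc) (ΠF h) n
      ≈⟨ +-cong (*-identityˡ _) (mulS-congˡ (ΠF h) n (F-suc (suc (suc h)))) ⟩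
    ΠF h (suc n) + mulS (mulS _ f) (ΠF h) n
      ≈⟨ +-congˡ (trans (mulS-assoc _ f (ΠF h) n) (mulS-fraction (suc (suc h)) (ΠF (suc h)) n)) ⟩
    ΠF h (suc n) + (0# * ΠF (suc h) n + α (suc (suc h)) * ΠF (suc (suc h)) n)
      ≈⟨ +-congˡ (trans (+-congʳ (zeroˡ _)) (+-identityˡ _)) ⟩
    ΠF h (suc n) + α (suc (suc h)) * ΠF (suc (suc h)) n ∎
    where f = F (suc (suc h))

  -- The series `tᵏ f`.
  shift : ℕ → PS → PS
  shift zero    f n       = f n
  shift (suc k) f zero    = 0#
  shift (suc k) f (suc n) = shift k f n

  shift-ΠF : ∀ k h n → shift k (ΠF (suc h)) n
                    ≈ shift k (ΠF h) n + α (suc (suc h)) * shift (suc k) (ΠF (suc (suc h))) n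
  shift-ΠF zero h zero = trans (trans (ΠF-zero (suc h)) (sym (ΠF-zero h)))
    (sym (trans (+-congˡ (zeroʳ _)) (+-identityʳ _)))
  shift-ΠF zero    h (suc n) = ΠF-suc h n
  shift-ΠF (suc k) h zero    = sym (trans (+-identityˡ _) (zeroʳ _))
  shift-ΠF (suc k) h (suc n) = shift-ΠF k h n

  -- The recursion for `H` and its solution by products of tails

  peakW dfallW valleyW driseW : ℕ → Carrier
  peakW   k = x₁ + nat· k u₁
  valleyW k = ỹ₁ + nat· k ṽ₁
  dfallW  k = x₂ + nat· k u₂ + wₑ
  driseW  k = y₂ + nat· k v₂ + wₒ

  -- H d k is the weighted number of ways to complete a partial D-permutation
  -- having k open positions by processing the elements d, d - 1, ..., 1.
  H Hₑ Hₒ : ℕ → ℕ → Carrier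
  H zero    zero    = 1#
  H zero    (suc k) = 0#
  H (suc d) k       = if isEvenᵇ (suc d) then Hₑ d k else Hₒ d k
  -- With nothing open a fixed point is a record-antirecord and weighs `zₑ` or `zₒ`. Otherwise it is
  -- neither, and its weight `wₑ` or `wₒ` is part of `dfallW` or `driseW`.
  Hₑ d zero    = peakW 0 * H d 1 + zₑ * H d 0
  Hₑ d (suc k) = peakW (suc k) * H d (suc (suc k)) + dfallW k * H d (suc k)
  Hₒ d zero    = zₒ * H d 0
  Hₒ d (suc k) = valleyW k * H d k + driseW k * H d (suc k)

  double : ℕ → ℕ
  double zero    = zero
  double (suc n) = suc (suc (double n))

  double≡2* : ∀ n → double n ≡ 2 ℕ.* n
  double≡2* zero    = ≡.refl
  double≡2* (suc n) = ≡.trans (≡.cong (2 ℕ.+_) (double≡2* n)) (≡.cong suc (≡.sym (ℕ.+-suc n (n ℕ.+ 0))))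

  double-even : ∀ n → isEvenᵇ (double n) ≡ true
  double-even zero    = ≡.refl
  double-even (suc n) = double-even n

  suc-double-odd : ∀ n → isEvenᵇ (suc (double n)) ≡ false
  suc-double-odd zero    = ≡.refl
  suc-double-odd (suc n) = suc-double-odd n

  double/2 : ∀ n → double n ℕ./ 2 ≡ n
  double/2 n = ≡.trans (≡.cong (ℕ._/ 2) (≡.trans (double≡2* n) (ℕ.*-comm 2 n))) (ℕ.m*n/n≡m n 2)

  suc-double/2 : ∀ n → suc (double n) ℕ./ 2 ≡ n
  suc-double/2 zero    = ≡.refl
  suc-double/2 (suc n) = ≡.trans (ℕ.m/n≡1+[m∸n]/n {suc (double (suc n))} {2} (s≤s (s≤s z≤n)))
                                 (≡.cong suc (suc-double/2 n))

  α-odd : ∀ k → α (suc (double k)) ≡ peakW k * valleyW k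
  α-odd k rewrite double-even k | double/2 k = ≡.refl

  α-even : ∀ k → α (suc (suc (double k))) ≡ dfallW k * driseW k
  α-even k rewrite suc-double-odd k | suc-double/2 k = ≡.refl

  H-odd : ∀ n k → H (suc (double n)) k ≡ Hₒ (double n) k
  H-odd n k rewrite suc-double-odd n = ≡.refl

  H-even : ∀ n k → H (double (suc n)) k ≡ Hₑ (suc (double n)) k
  H-even n k rewrite double-even n = ≡.refl

  -- Read a state with `k` open points as height `2k` before an even element and, for `k > 0`,
  -- `2k - 1` before an odd one. Every element is then a step up or down, except that two fixed
  -- points with nothing open form a level step `zₑ * zₒ`. Each `α` is the weight of an up step
  -- times that of the matching down step. From height `2k` there remain `2k` unmatched down steps:
  -- their weight is `openW k`, and they account for the shift by `k`.
  openW : ℕ → Carrier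
  openW zero    = 1#
  openW (suc k) = openW k * valleyW k * dfallW k

  H-double : ∀ n k → H (double n) k ≈ openW k * shift k (ΠF (double k)) n
  -- The middle of a level step: only a fixed point can follow.
  H-suc-double₀ : ∀ n → H (suc (double n)) 0 ≈ zₒ * ΠF 0 n
  H-suc-double : ∀ n k → H (suc (double n)) (suc k)
                       ≈ openW k * valleyW k * shift k (ΠF (suc (double k))) n

  H-double zero    zero    = sym (*-identityˡ _)
  H-double zero    (suc k) = sym (zeroʳ _)
  H-double (suc n) zero    = begin
    H (double (suc n)) 0
      ≈⟨ reflexive (H-even n 0) ⟩
    peakW 0 * H (suc (double n)) 1 + zₑ * H (suc (double n)) 0
      ≈⟨ +-cong (*-congˡ (H-suc-double n 0)) (*-congˡ (H-suc-double₀ n)) ⟩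
    peakW 0 * (1# * valleyW 0 * ΠF 1 n) + zₑ * (zₒ * ΠF 0 n)
      ≈⟨ solve 6 (λ p v t e o s → p :* (con 1 :* v :* t) :+ e :* (o :* s)
                               := con 1 :* (e :* o :* s :+ p :* v :* t)) ≈-refl _ _ _ _ _ _ ⟩
    1# * (zₑ * zₒ * ΠF 0 n + α 1 * ΠF 1 n)
      ≈⟨ *-congˡ (ΠF₀-suc n) ⟨
    1# * ΠF 0 (suc n) ∎
  H-double (suc n) (suc k) = begin
    H (double (suc n)) (suc k)
      ≈⟨ reflexive (H-even n (suc k)) ⟩
    peakW (suc k) * H (suc (double n)) (suc (suc k)) + dfallW k * H (suc (double n)) (suc k)
      ≈⟨ +-cong (*-congˡ (H-suc-double n (suc k))) (*-congˡ (H-suc-double n k)) ⟩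
    peakW (suc k) * (openW k * valleyW k * dfallW k * valleyW (suc k) * t) + dfallW k * (openW k * valleyW k * s)
      ≈⟨ solve 7 (λ p a v f w t s → p :* (a :* v :* f :* w :* t) :+ f :* (a :* v :* s)
                                 := a :* v :* f :* (s :+ p :* w :* t)) ≈-refl _ _ _ _ _ _ _ ⟩
    openW (suc k) * (s + peakW (suc k) * valleyW (suc k) * t)
      ≈⟨ *-congˡ (+-congˡ (*-congʳ (reflexive (α-odd (suc k))))) ⟨
    openW (suc k) * (s + α (suc (double (suc k))) * t)
      ≈⟨ *-congˡ (shift-ΠF k (suc (double k)) n) ⟨
    openW (suc k) * shift (suc k) (ΠF (double (suc k))) (suc n) ∎
    where
    s = shift k (ΠF (suc (double k))) n
    t = shift (suc k) (ΠF (suc (double (suc k)))) n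

  H-suc-double₀ n = trans (reflexive (H-odd n 0)) (*-congˡ (trans (H-double n 0) (*-identityˡ _)))

  H-suc-double n k = begin
    H (suc (double n)) (suc k)
      ≈⟨ reflexive (H-odd n (suc k)) ⟩
    valleyW k * H (double n) k + driseW k * H (double n) (suc k)
      ≈⟨ +-cong (*-congˡ (H-double n k)) (*-congˡ (H-double n (suc k))) ⟩
    valleyW k * (openW k * s) + driseW k * (openW k * valleyW k * dfallW k * t)
      ≈⟨ solve 6 (λ v a s d f t → v :* (a :* s) :+ d :* (a :* v :* f :* t)
                               := a :* v :* (s :+ f :* d :* t)) ≈-refl _ _ _ _ _ _ ⟩
    openW k * valleyW k * (s + dfallW k * driseW k * t)
      ≈⟨ *-congˡ (+-congˡ (*-congʳ (reflexive (α-even k)))) ⟨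
    openW k * valleyW k * (s + α (suc (suc (double k))) * t)
      ≈⟨ *-congˡ (shift-ΠF k (double k) n) ⟨
    openW k * valleyW k * shift k (ΠF (suc (double k))) n ∎
    where
    s = shift k (ΠF (double k)) n
    t = shift (suc k) (ΠF (double (suc k))) n

  H-TFraction : ∀ n → TFracCoeff n (H (2 ℕ.* n) 0)
  H-TFraction n = n , λ N n≤N → begin
    conv N 1 n          ≈⟨ conv-stable n N 1 n≤N ⟩
    F 1 n               ≈⟨ *-identityˡ _ ⟨
    1# * F 1 n          ≈⟨ H-double n 0 ⟨
    H (double n) 0      ≡⟨ ≡.cong (λ m → H m 0) (double≡2* n) ⟩
    H (2 ℕ.* n) 0       ∎

  -- Sums over finite sets

  module _ {A : Set} (g : A → Carrier) where

    sumR-map-↭ : ∀ {xs ys} → xs ↭ ys → sumR (map g xs) ≈ sumR (map g ys)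
    sumR-map-↭ ↭.refl          = ≈-refl
    sumR-map-↭ (↭.prep x p)    = +-congˡ (sumR-map-↭ p)
    sumR-map-↭ (↭.swap x y p)  = trans (+-congˡ (+-congˡ (sumR-map-↭ p)))
      (solve 3 (λ a b c → a :+ (b :+ c) := b :+ (a :+ c)) ≈-refl _ _ _)
    sumR-map-↭ (↭.trans p q)   = trans (sumR-map-↭ p) (sumR-map-↭ q)

    sumR-map-++ : ∀ xs ys → sumR (map g (xs ++ ys)) ≈ sumR (map g xs) + sumR (map g ys)
    sumR-map-++ []       ys = sym (+-identityˡ _)
    sumR-map-++ (x ∷ xs) ys = trans (+-congˡ (sumR-map-++ xs ys)) (sym (+-assoc _ _ _))

  -- The list is carried along as a witness, so sums over classes can be formed without deciding
  -- membership in them.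
  record SumOver {A : Set} (Q : A → Set) (g : A → Carrier) (x : Carrier) : Set ℓ where
    field
      list     : List A
      unique   : Unique list
      sound    : ∀ {v} → v ∈ list → Q v
      complete : ∀ {v} → Q v → v ∈ list
      total    : sumR (map g list) ≈ x

  open SumOver

  module _ {A : Set} {g : A → Carrier} where

    -- Duplicate-free lists with the same members are permutations of each other, so the total does
    -- not depend on the enumeration.
    sumOver-list : ∀ {Q x} → SumOver Q g x → ∀ {vs} → Unique vs →
                   (∀ {v} → v ∈ vs → Q v) → (∀ {v} → Q v → v ∈ vs) → sumR (map g vs) ≈ x
    sumOver-list s vs! vs⇒Q Q⇒vs = trans
      (sumR-map-↭ g (∼bag⇒↭ (unique∧set⇒bag vs! (unique s) (mk⇔ (complete s ∘ vs⇒Q) (Q⇒vs ∘ sound s)))))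
      (total s)

    sumOver-empty : ∀ {Q} → (∀ {v} → ¬ Q v) → SumOver Q g 0#
    sumOver-empty ¬Q = record
      { list = [] ; unique = [] ; sound = λ () ; complete = λ q → contradiction q ¬Q ; total = ≈-refl }

    sumOver-single : ∀ {Q : A → Set} {v₀} → Q v₀ → (∀ {v} → Q v → v ≡ v₀) → SumOver Q g (g v₀)
    sumOver-single {v₀ = v₀} q₀ q! = record
      { list = [ v₀ ] ; unique = [] ∷ [] ; sound = λ { (here refl) → q₀ }
      ; complete = here ∘ q! ; total = +-identityʳ _ }

    sumOver-resp : ∀ {Q Q′ : A → Set} {x y} → (∀ {v} → Q v → Q′ v) → (∀ {v} → Q′ v → Q v) → x ≈ y →
                   SumOver Q g x → SumOver Q′ g y
    sumOver-resp to from x≈y s = record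
      { list = list s ; unique = unique s ; sound = to ∘ sound s ; complete = complete s ∘ from
      ; total = trans (total s) x≈y }

    sumOver-∪ : ∀ {Q Q′ : A → Set} {x y} → SumOver Q g x → SumOver Q′ g y →
                (∀ {v} → Q v → ¬ Q′ v) → SumOver (λ v → Q v ⊎ Q′ v) g (x + y)
    sumOver-∪ s t disjoint = record
      { list = list s ++ list t
      ; unique = ++⁺ (unique s) (unique t) λ (v∈s , v∈t) → disjoint (sound s v∈s) (sound t v∈t)
      ; sound = Sum.map (sound s) (sound t) ∘ ∈-++⁻ (list s)
      ; complete = λ { (inj₁ q) → ∈-++⁺ˡ (complete s q) ; (inj₂ q) → ∈-++⁺ʳ (list s) (complete t q) }
      ; total = trans (sumR-map-++ g (list s) (list t)) (+-cong (total s) (total t))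
      }

    sumOver-⋃ : ∀ {k} {Q : Fin k → A → Set} {x : Vector Carrier k} → (∀ j → SumOver (Q j) g (x j)) →
                (∀ {j j′ v} → Q j v → Q j′ v → j ≡ j′) → SumOver (λ v → ∃ λ j → Q j v) g (sum x)
    sumOver-⋃ {zero}  s disjoint = sumOver-empty λ { (() , _) }
    sumOver-⋃ {suc k} s disjoint = sumOver-resp
      (λ { (inj₁ q) → zero , q ; (inj₂ (j , q)) → suc j , q })
      (λ { (zero , q) → inj₁ q ; (suc j , q) → inj₂ (j , q) })
      ≈-refl
      (sumOver-∪ (s zero) (sumOver-⋃ (s ∘ suc) (λ q q′ → Fin.suc-injective (disjoint q q′)))
                 (λ { q (j , q′) → contradiction (disjoint q q′) λ () }))

    sumOver-scale : ∀ {Q : A → Set} {h : A → Carrier} {a x} → (∀ {v} → Q v → h v ≈ a * g v) →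
                    SumOver Q g x → SumOver Q h (a * x)
    sumOver-scale {h = h} {a} e s = record
      { list = list s ; unique = unique s ; sound = sound s ; complete = complete s
      ; total = trans (go (list s) (sound s)) (*-congˡ (total s)) }
      where
      go : ∀ vs → (∀ {v} → v ∈ vs → _) → sumR (map h vs) ≈ a * sumR (map g vs)
      go []       _ = sym (zeroʳ a)
      go (v ∷ vs) q = trans (+-cong (e (q (here refl))) (go vs (q ∘ Any.there))) (sym (distribˡ a _ _))
        where import Data.List.Relation.Unary.Any as Any

  sum-*ʳ : ∀ {k} (f : Fin k → Carrier) x → sum (λ j → f j * x) ≈ sum f * x
  sum-*ʳ f x = sym (*-distribʳ-sum x f)

  -- Sums over the choice of an open point

  module Labelled (hi lo : Bool → Carrier) where

    pick : Bool → Bool → Carrier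
    pick last b = if last then hi b else lo b

    Φ : ∀ {k} → (Fin k → Bool) → Carrier
    Φ {zero}  w = 1#
    Φ {suc k} w = Φ (w ∘ suc) * (hi (w zero) + nat· k (lo (w zero)))

    -- Picking the smallest point costs `l` and removes its factor. Picking a larger one lowers that
    -- factor from `h + (k + 1) l` to `h + k l`, and induction applies to the larger points. The two
    -- contributions add up to the original factor.
    sum-pick : ∀ {k} (w : Fin (suc k) → Bool) →
               sum (λ j → pick (isLast j) (w j) * Φ (w ∘ punchIn j)) ≈ Φ w
    sum-pick {zero}  w = solve 1 (λ h → h :* con 1 :+ con 0 := con 1 :* (h :+ con 0)) ≈-refl _
    sum-pick {suc k} w = begin
      l * Φ (w ∘ suc) + sum (λ j → pick (isLast j) (w (suc j)) * (Φ (w ∘ suc ∘ punchIn j) * b))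
        ≈⟨ +-congˡ (sum-cong-≋ λ j →
             sym (*-assoc (pick (isLast j) (w (suc j))) (Φ (w ∘ suc ∘ punchIn j)) b)) ⟩
      l * Φ (w ∘ suc) + sum (λ j → pick (isLast j) (w (suc j)) * Φ (w ∘ suc ∘ punchIn j) * b)
        ≈⟨ +-congˡ (sum-*ʳ (λ j → pick (isLast j) (w (suc j)) * Φ (w ∘ suc ∘ punchIn j)) b) ⟩
      l * Φ (w ∘ suc) + sum (λ j → pick (isLast j) (w (suc j)) * Φ (w ∘ suc ∘ punchIn j)) * b
        ≈⟨ +-congˡ (*-congʳ (sum-pick (w ∘ suc))) ⟩
      l * Φ (w ∘ suc) + Φ (w ∘ suc) * (h + nat· k l)
        ≈⟨ solve 4 (λ l p h n → l :* p :+ p :* (h :+ n) := p :* (h :+ (l :+ n))) ≈-refl _ _ _ _ ⟩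
      Φ (w ∘ suc) * (h + (l + nat· k l)) ∎
      where
      h = hi (w zero)
      l = lo (w zero)
      b = h + nat· k l

    sum-pick-* : ∀ {k} (w : Fin (suc k) → Bool) r x →
                 sum (λ j → pick (isLast j) (w j) * (Φ (w ∘ punchIn j) * r * x)) ≈ Φ w * (r * x)
    sum-pick-* w r x = trans
      (sum-cong-≋ λ j → solve 4 (λ a b r x → a :* (b :* r :* x) := a :* b :* (r :* x)) ≈-refl
        (pick (isLast j) (w j)) (Φ (w ∘ punchIn j)) r x)
      (trans (sum-*ʳ (λ j → pick (isLast j) (w j) * Φ (w ∘ punchIn j)) (r * x)) (*-congʳ (sum-pick w)))

  sum-const : ∀ k a → sum {k} (λ _ → a) ≈ nat· k a
  sum-const zero    a = ≈-refl
  sum-const (suc k) a = +-congˡ (sum-const k a)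

  sum-isLast : ∀ k a b → sum (λ (j : Fin (suc k)) → if isLast j then a else b) ≈ a + nat· k b
  sum-isLast zero    a b = ≈-refl
  sum-isLast (suc k) a b = trans (+-congˡ (sum-isLast k a b))
    (solve 3 (λ a b n → b :+ (a :+ n) := a :+ (b :+ n)) ≈-refl _ _ _)

  sum-≟ : ∀ {k} (j₀ : Fin (suc k)) a b → sum (λ j → if does (j Fin.≟ j₀) then a else b) ≈ a + nat· k b
  sum-≟ {k}     zero     a b = +-congˡ (sum-const k b)
  sum-≟ {suc k} (suc j₀) a b = trans (+-congˡ (trans (sum-cong-≋ λ j → reflexive (same j)) (sum-≟ j₀ a b)))
    (solve 3 (λ a b n → b :+ (a :+ n) := a :+ (b :+ n)) ≈-refl _ _ _)
    where
    same : ∀ j → (if does (suc j Fin.≟ suc j₀) then a else b) ≡ (if does (j Fin.≟ j₀) then a else b)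
    same j with j Fin.≟ j₀
    ... | yes _ = refl
    ... | no _  = refl

  -- Weights as products of local factors

  factor : Carrier → Bool → Carrier
  factor a b = pow a (if b then 1 else 0)

  pow-+ : ∀ a m n → pow a (m ℕ.+ n) ≈ pow a m * pow a n
  pow-+ a zero    n = sym (*-identityˡ _)
  pow-+ a (suc m) n = trans (*-congˡ (pow-+ a m n)) (sym (*-assoc _ _ _))

  pow-sum : ∀ a {m n} (g : Fin n → Fin m) (f : Fin m → ℕ) →
            pow a (ℕ.sum (map f (List.tabulate g))) ≈ prod (λ i → pow a (f (g i)))
  pow-sum a {n = zero}  g f = ≈-refl
  pow-sum a {n = suc n} g f = trans (pow-+ a (f (g zero)) _) (*-congˡ (pow-sum a (g ∘ suc) f))

  -- A record and not a bare equation, so that the vectors of factors can be inferred when twelve of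
  -- them are combined.
  record _IsProd_ (x : Carrier) {m} (f : Vector Carrier m) : Set ℓ where
    constructor isProd
    field ≈prod : x ≈ prod f

  infixl 7 _⊛_
  _⊛_ : ∀ {m x y} {f g : Vector Carrier m} → x IsProd f → y IsProd g → (x * y) IsProd (λ i → f i * g i)
  _⊛_ {f = f} {g} (isProd e) (isProd e′) = isProd (trans (*-cong e e′) (sym (prod-distrib-* f g)))

  ≈prod-cong : ∀ {m x} {f g : Vector Carrier m} → x IsProd f → (∀ i → f i ≈ g i) → x ≈ prod g
  ≈prod-cong {m} {f = f} {g} (isProd e) f≈g = trans e (prod-cong {m} {f} {g} f≈g)

  module _ {m} (σ : Fin m → Fin m) where
    open Stats σ

    pow-count : ∀ a p → pow a (count p) IsProd (λ i → factor a (p i))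
    pow-count a p = isProd (pow-sum a (λ i → i) (λ i → if p i then 1 else 0))

  -- The weight of the elements still to be read at threshold `d`.
  prodBelow : ∀ {m} → ℕ → (Fin m → Carrier) → Carrier
  prodBelow d f = prod (λ i → if toℕ i <ᵇ d then f i else 1#)

  prodBelow-zero : ∀ {m} (f : Fin m → Carrier) → prodBelow 0 f ≈ 1#
  prodBelow-zero {m} f = prod-replicate-one m

  prodBelow-all : ∀ {m} (f : Fin m → Carrier) → prodBelow m f ≈ prod f
  prodBelow-all f = prod-cong λ i → reflexive (≡.cong (if_then f i else 1#) (<ᵇ-true (Fin.toℕ<n i)))

  prodBelow-suc : ∀ {m} (f : Fin m → Carrier) i → prodBelow (suc (toℕ i)) f ≈ f i * prodBelow (toℕ i) f
  prodBelow-suc {suc m} f i = begin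
    prod t                               ≈⟨ prod-remove {i = i} t ⟩
    t i * prod (Vector.removeAt t i)     ≈⟨ *-cong (reflexive t-i) (prod-cong λ j → reflexive (t≡s j)) ⟩
    f i * prod (Vector.removeAt s i)     ≈⟨ *-congˡ (*-identityˡ _) ⟨
    f i * (1# * prod (Vector.removeAt s i)) ≈⟨ *-congˡ (*-congʳ (reflexive s-i)) ⟨
    f i * (s i * prod (Vector.removeAt s i)) ≈⟨ *-congˡ (prod-remove {i = i} s) ⟨
    f i * prod s                         ∎
    where
    t = λ j → if toℕ j <ᵇ suc (toℕ i) then f j else 1#
    s = λ j → if toℕ j <ᵇ toℕ i then f j else 1#
    t-i : t i ≡ f i
    t-i rewrite <ᵇ-true (ℕ.n<1+n (toℕ i)) = refl
    s-i : s i ≡ 1#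
    s-i rewrite <ᵇ-false (ℕ.≤-refl {toℕ i}) = refl
    t≡s : ∀ j → t (punchIn i j) ≡ s (punchIn i j)
    t≡s j with ℕ.<-cmp (toℕ (punchIn i j)) (toℕ i)
    ... | tri< lt _ _ rewrite <ᵇ-true lt | <ᵇ-true (ℕ.m≤n⇒m≤1+n lt) = refl
    ... | tri≈ _ eq _ = contradiction (Fin.toℕ-injective eq) (Fin.punchInᵢ≢i i j)
    ... | tri> _ _ gt rewrite <ᵇ-false gt | <ᵇ-false (ℕ.<⇒≤ gt) = refl

  infixr 7 _when_·_
  -- An absent factor is dropped instead of becoming `1#`, so for concrete flags a monomial reduces
  -- to the few factors that are present.
  _when_·_ : Carrier → Bool → Carrier → Carrier
  a when b · x = if b then a * x else x

  when-factor : ∀ {a x y} b → x ≈ y → a when b · x ≈ factor a b * y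
  when-factor true  x≈y = *-cong (sym (*-identityʳ _)) x≈y
  when-factor false x≈y = trans x≈y (sym (*-identityˡ _))

  record Exponents : Set where
    constructor exponents
    field X₁ X₂ U₁ U₂ Y₂ V₂ Y₁ V₁ Wₑ Wₒ Zₑ Zₒ : Bool

  -- The order puts every factor that belongs to a choice of an open point before `ỹ₁` and `ṽ₁`, so
  -- the weight at a valley reduces to such a factor times that of the minimum.
  monomial : Exponents → Carrier
  monomial (exponents X₁ X₂ U₁ U₂ Y₂ V₂ Y₁ V₁ Wₑ Wₒ Zₑ Zₒ) =
    x₁ when X₁ · x₂ when X₂ · u₁ when U₁ · u₂ when U₂ · y₂ when Y₂ · v₂ when V₂ ·
    ỹ₁ when Y₁ · ṽ₁ when V₁ · wₑ when Wₑ · wₒ when Wₒ · zₑ when Zₑ · zₒ when Zₒ · 1#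

  monomial-factors : ∀ e → let open Exponents e in
    factor x₁ X₁ * factor x₂ X₂ * factor ỹ₁ Y₁ * factor y₂ Y₂ * factor u₁ U₁ * factor u₂ U₂ *
    factor ṽ₁ V₁ * factor v₂ V₂ * factor wₑ Wₑ * factor wₒ Wₒ * factor zₑ Zₑ * factor zₒ Zₒ
    ≈ monomial e
  monomial-factors (exponents X₁ X₂ U₁ U₂ Y₂ V₂ Y₁ V₁ Wₑ Wₒ Zₑ Zₒ) = trans
    (solve 12 (λ x₁ x₂ ỹ₁ y₂ u₁ u₂ ṽ₁ v₂ wₑ wₒ zₑ zₒ →
      x₁ :* x₂ :* ỹ₁ :* y₂ :* u₁ :* u₂ :* ṽ₁ :* v₂ :* wₑ :* wₒ :* zₑ :* zₒ
      := x₁ :* (x₂ :* (u₁ :* (u₂ :* (y₂ :* (v₂ :* (ỹ₁ :* (ṽ₁ :* (wₑ :* (wₒ :* (zₑ :* (zₒ :* con 1))))))))))))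
      ≈-refl _ _ _ _ _ _ _ _ _ _ _ _)
    (sym (when-factor X₁ (when-factor X₂ (when-factor U₁ (when-factor U₂ (when-factor Y₂ (when-factor V₂
      (when-factor Y₁ (when-factor V₁ (when-factor Wₑ (when-factor Wₒ (when-factor Zₑ (when-factor Zₒ
        ≈-refl)))))))))))))

  module _ {m} (σ : Fin m → Fin m) where
    open Stats σ

    -- The peak and double-fall statistics of p = σ⁻¹(i) are attributed to i = σ(p).
    local : Fin m → Exponents
    local i = exponents
      (cpeak p ∧ earec p) (cdfall p ∧ earec p) (cpeak p ∧ nrar p) (cdfall p ∧ nrar p)
      (cdrise i ∧ erec i) (cdrise i ∧ nrar i) (cvalley i ∧ cycmin i) (cvalley i ∧ not (cycmin i))
      (fixed i ∧ nrar i ∧ isEvenᵇ (val i)) (fixed i ∧ nrar i ∧ isOddᵇ (val i))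
      (rar i ∧ isEvenᵇ (val i)) (rar i ∧ isOddᵇ (val i))
      where p = σinv i

    -- The peak and double-rise statistics of q = σ(i) are attributed to i = σ⁻¹(q).
    local′ : Fin m → Exponents
    local′ i = exponents
      (cpeak q ∧ erec i) (cdfall i ∧ earec p) (cpeak q ∧ nrar i) (cdfall i ∧ nrar p)
      (cdrise q ∧ erec i) (cdrise q ∧ nrar i) (cvalley i ∧ cycmin i) (cvalley i ∧ not (cycmin i))
      (fixed i ∧ nrar i ∧ isEvenᵇ (val i)) (fixed i ∧ nrar i ∧ isOddᵇ (val i))
      (rar i ∧ isEvenᵇ (val i)) (rar i ∧ isOddᵇ (val i))
      where
      p = σinv i
      q = σ i

    module _ (injective : ∀ {i j} → σ i ≡ σ j → i ≡ j) where
      open Injective injective using (σ-σinv; σinv-σ)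

      perm : Perm.Permutation m m
      perm = Perm.permutation σ σinv σ-σinv σinv-σ

      pow-count-σinv : ∀ a p → pow a (count p) IsProd (λ i → factor a (p (σinv i)))
      pow-count-σinv a p =
        isProd (trans (_IsProd_.≈prod (pow-count σ a p)) (prod-permute (factor a ∘ p) (Perm.flip perm)))

      -- Reindexing the product by `σ` turns a condition on the preimage of a peak or double rise
      -- into one on the element read.
      pow-count-σ : ∀ a (p r : Fin m → Bool) →
                    pow a (count (λ i → p i ∧ r (σinv i))) IsProd (λ i → factor a (p (σ i) ∧ r i))
      pow-count-σ a p r = isProd (trans (_IsProd_.≈prod (pow-count σ a (λ i → p i ∧ r (σinv i))))
        (trans (prod-permute (λ i → factor a (p i ∧ r (σinv i))) perm)
               (prod-cong {m} λ i → reflexive (≡.cong (λ j → factor a (p (σ i) ∧ r j)) (σinv-σ i)))))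

      weight≈prod : weight σ ≈ prod (monomial ∘ local)
      weight≈prod = ≈prod-cong
        (pow-count-σinv x₁ (λ i → cpeak i ∧ earec i) ⊛ pow-count-σinv x₂ (λ i → cdfall i ∧ earec i)
         ⊛ pow-count σ ỹ₁ (λ i → cvalley i ∧ cycmin i) ⊛ pow-count σ y₂ (λ i → cdrise i ∧ erec i)
         ⊛ pow-count-σinv u₁ (λ i → cpeak i ∧ nrar i) ⊛ pow-count-σinv u₂ (λ i → cdfall i ∧ nrar i)
         ⊛ pow-count σ ṽ₁ (λ i → cvalley i ∧ not (cycmin i)) ⊛ pow-count σ v₂ (λ i → cdrise i ∧ nrar i)
         ⊛ pow-count σ wₑ (λ i → fixed i ∧ nrar i ∧ isEvenᵇ (val i))
         ⊛ pow-count σ wₒ (λ i → fixed i ∧ nrar i ∧ isOddᵇ (val i))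
         ⊛ pow-count σ zₑ (λ i → rar i ∧ isEvenᵇ (val i)) ⊛ pow-count σ zₒ (λ i → rar i ∧ isOddᵇ (val i)))
        (λ i → monomial-factors (local i))

      weight′≈prod : weight′ σ ≈ prod (monomial ∘ local′)
      weight′≈prod = ≈prod-cong
        (pow-count-σ x₁ cpeak erec ⊛ pow-count σ x₂ (λ i → cdfall i ∧ earec (σinv i))
         ⊛ pow-count σ ỹ₁ (λ i → cvalley i ∧ cycmin i) ⊛ pow-count-σ y₂ cdrise erec
         ⊛ pow-count-σ u₁ cpeak nrar ⊛ pow-count σ u₂ (λ i → cdfall i ∧ nrar (σinv i))
         ⊛ pow-count σ ṽ₁ (λ i → cvalley i ∧ not (cycmin i)) ⊛ pow-count-σ v₂ cdrise nrar
         ⊛ pow-count σ wₑ (λ i → fixed i ∧ nrar i ∧ isEvenᵇ (val i))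
         ⊛ pow-count σ wₒ (λ i → fixed i ∧ nrar i ∧ isOddᵇ (val i))
         ⊛ pow-count σ zₑ (λ i → rar i ∧ isEvenᵇ (val i)) ⊛ pow-count σ zₒ (λ i → rar i ∧ isOddᵇ (val i)))
        (λ i → monomial-factors (local′ i))

  -- An open point is labelled false if it is a peak, true if it is a double fall
  -- (for P) or a double rise (for P′).
  hi hi′ lo lo′ : Bool → Carrier
  hi  b = if b then x₂ else x₁
  lo  b = if b then u₂ else u₁
  hi′ b = if b then y₂ else x₁
  lo′ b = if b then v₂ else u₁

  open Labelled hi lo
  open Labelled hi′ lo′ using () renaming (pick to pick′; Φ to Φ′; sum-pick to sum-pick′; sum-pick-* to sum-pick-*′)

  minW : Bool → Carrier
  minW b = if b then ỹ₁ else ṽ₁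

  module _ (F : Flags) where
    open Flags F

    -- The entries copy those of `local` and `local′`, which makes `W` and `W′` at `flagsAt σ i`
    -- definitionally equal to the factors in `weight≈prod` and `weight′≈prod`.
    exps exps′ : Exponents
    exps = exponents
      ((pinv< ∧ pim<) ∧ parec ∧ not prec) ((p<inv ∧ pim<) ∧ parec ∧ not prec)
      ((pinv< ∧ pim<) ∧ not prec ∧ not parec) ((p<inv ∧ pim<) ∧ not prec ∧ not parec)
      ((inv< ∧ <im) ∧ rec ∧ not arec) ((inv< ∧ <im) ∧ not rec ∧ not arec)
      ((<inv ∧ <im) ∧ cyc) ((<inv ∧ <im) ∧ not cyc)
      (fix ∧ (not rec ∧ not arec) ∧ ev) (fix ∧ (not rec ∧ not arec) ∧ od)
      ((rec ∧ arec) ∧ ev) ((rec ∧ arec) ∧ od)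
    exps′ = exponents
      ((qinv< ∧ qim<) ∧ rec ∧ not arec) ((<inv ∧ im<) ∧ parec ∧ not prec)
      ((qinv< ∧ qim<) ∧ not rec ∧ not arec) ((<inv ∧ im<) ∧ not prec ∧ not parec)
      ((qinv< ∧ q<im) ∧ rec ∧ not arec) ((qinv< ∧ q<im) ∧ not rec ∧ not arec)
      ((<inv ∧ <im) ∧ cyc) ((<inv ∧ <im) ∧ not cyc)
      (fix ∧ (not rec ∧ not arec) ∧ ev) (fix ∧ (not rec ∧ not arec) ∧ od)
      ((rec ∧ arec) ∧ ev) ((rec ∧ arec) ∧ od)

    W W′ : Carrier
    W  = monomial exps
    W′ = monomial exps′

  -- The local weight of each kind of element

  private
    1ʳ : ∀ {x} → x * 1# ≈ x
    1ʳ = *-identityʳ _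

  module _ (F : Flags) where
    open Flags F

    -- A peak is charged when it is picked later, so it contributes nothing here. The undetermined
    -- flags are split because a conjunction is stuck until its left argument is known; the same
    -- applies to the lemmas that follow.
    W-peak : inv< ≡ true → <inv ≡ false → <im ≡ false → fix ≡ false → rec ≡ false → pim< ≡ false → W F ≈ 1#
    W-peak refl refl refl refl refl refl with pinv< | p<inv
    ... | true  | true  = ≈-refl
    ... | true  | false = ≈-refl
    ... | false | true  = ≈-refl
    ... | false | false = ≈-refl

    W-fix-open : ∀ {b} → od ≡ b → ev ≡ not b → inv< ≡ false → <inv ≡ false → fix ≡ true →
                 rec ≡ false → arec ≡ false → pim< ≡ false → W F ≈ (if b then wₒ else wₑ)
    W-fix-open {b} refl refl refl refl refl refl refl refl with pinv< | p<inv | b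
    ... | true  | true  | true  = 1ʳ
    ... | true  | false | true  = 1ʳ
    ... | false | true  | true  = 1ʳ
    ... | false | false | true  = 1ʳ
    ... | true  | true  | false = 1ʳ
    ... | true  | false | false = 1ʳ
    ... | false | true  | false = 1ʳ
    ... | false | false | false = 1ʳ

    W-fix-closed : ∀ {b} → od ≡ b → ev ≡ not b → inv< ≡ false → <inv ≡ false → fix ≡ true →
                   rec ≡ true → arec ≡ true → pim< ≡ false → W F ≈ (if b then zₒ else zₑ)
    W-fix-closed {b} refl refl refl refl refl refl refl refl with pinv< | p<inv | b
    ... | true  | true  | true  = 1ʳ
    ... | true  | false | true  = 1ʳ
    ... | false | true  | true  = 1ʳ
    ... | false | false | true  = 1ʳ
    ... | true  | true  | false = 1ʳ
    ... | true  | false | false = 1ʳ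
    ... | false | true  | false = 1ʳ
    ... | false | false | false = 1ʳ

    W-dfall : ∀ {w last} → inv< ≡ false → <im ≡ false → <inv ≡ true → fix ≡ false → rec ≡ false → pim< ≡ true →
              pinv< ≡ not w → p<inv ≡ w → prec ≡ false → parec ≡ last → W F ≈ pick last w
    W-dfall {w} {last} refl refl refl refl refl refl refl refl refl refl with w | last
    ... | true  | true  = 1ʳ
    ... | true  | false = 1ʳ
    ... | false | true  = 1ʳ
    ... | false | false = 1ʳ

    W-valley : ∀ {w last c} → inv< ≡ false → <inv ≡ true → <im ≡ true → fix ≡ false → arec ≡ false → pim< ≡ true →
               pinv< ≡ not w → p<inv ≡ w → prec ≡ false → parec ≡ last → cyc ≡ c → W F ≈ pick last w * minW c
    W-valley {w} {last} {c} refl refl refl refl refl refl refl refl refl refl refl with rec | w | last | c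
    ... | true  | true  | true  | true  = *-congˡ 1ʳ
    ... | true  | true  | false | true  = *-congˡ 1ʳ
    ... | true  | false | true  | true  = *-congˡ 1ʳ
    ... | true  | false | false | true  = *-congˡ 1ʳ
    ... | true  | true  | true  | false = *-congˡ 1ʳ
    ... | true  | true  | false | false = *-congˡ 1ʳ
    ... | true  | false | true  | false = *-congˡ 1ʳ
    ... | true  | false | false | false = *-congˡ 1ʳ
    ... | false | true  | true  | true  = *-congˡ 1ʳ
    ... | false | true  | false | true  = *-congˡ 1ʳ
    ... | false | false | true  | true  = *-congˡ 1ʳ
    ... | false | false | false | true  = *-congˡ 1ʳ
    ... | false | true  | true  | false = *-congˡ 1ʳ
    ... | false | true  | false | false = *-congˡ 1ʳ
    ... | false | false | true  | false = *-congˡ 1ʳ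
    ... | false | false | false | false = *-congˡ 1ʳ

    W-drise : ∀ {last} → inv< ≡ true → <inv ≡ false → <im ≡ true → fix ≡ false → arec ≡ false → rec ≡ last →
              pim< ≡ false → W F ≈ (if last then y₂ else v₂)
    W-drise {last} refl refl refl refl refl refl refl with pinv< | p<inv | last
    ... | true  | true  | true  = 1ʳ
    ... | true  | false | true  = 1ʳ
    ... | false | true  | true  = 1ʳ
    ... | false | false | true  = 1ʳ
    ... | true  | true  | false = 1ʳ
    ... | true  | false | false = 1ʳ
    ... | false | true  | false = 1ʳ
    ... | false | false | false = 1ʳ

    W′-peak : <inv ≡ false → fix ≡ false → rec ≡ false → qinv< ≡ false → W′ F ≈ 1#
    W′-peak refl refl refl refl = ≈-refl

    W′-fix-open : ∀ {b} → od ≡ b → ev ≡ not b → <inv ≡ false → fix ≡ true →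
                  rec ≡ false → arec ≡ false → qinv< ≡ false → W′ F ≈ (if b then wₒ else wₑ)
    W′-fix-open {b} refl refl refl refl refl refl refl with b
    ... | true  = 1ʳ
    ... | false = 1ʳ

    W′-fix-closed : ∀ {b} → od ≡ b → ev ≡ not b → <inv ≡ false → fix ≡ true →
                    rec ≡ true → arec ≡ true → qinv< ≡ false → W′ F ≈ (if b then zₒ else zₑ)
    W′-fix-closed {b} refl refl refl refl refl refl refl with b
    ... | true  = 1ʳ
    ... | false = 1ʳ

    W′-dfall : ∀ {last} → im< ≡ true → <inv ≡ true → <im ≡ false → fix ≡ false → rec ≡ false → qinv< ≡ false →
               prec ≡ false → parec ≡ last → W′ F ≈ (if last then x₂ else u₂)
    W′-dfall {last} refl refl refl refl refl refl refl refl with last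
    ... | true  = 1ʳ
    ... | false = 1ʳ

    W′-drise : ∀ {w last} → <inv ≡ false → fix ≡ false → arec ≡ false → rec ≡ last → qinv< ≡ true →
               qim< ≡ not w → q<im ≡ w → W′ F ≈ pick′ last w
    W′-drise {w} {last} refl refl refl refl refl refl refl with w | last
    ... | true  | true  = 1ʳ
    ... | true  | false = 1ʳ
    ... | false | true  = 1ʳ
    ... | false | false = 1ʳ

    W′-valley : ∀ {w last c} → im< ≡ false → <inv ≡ true → <im ≡ true → fix ≡ false → arec ≡ false → rec ≡ last →
                qinv< ≡ true → qim< ≡ not w → q<im ≡ w → cyc ≡ c → W′ F ≈ pick′ last w * minW c
    W′-valley {w} {last} {c} refl refl refl refl refl refl refl refl refl refl with w | last | c
    ... | true  | true  | true  = *-congˡ 1ʳ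
    ... | true  | false | true  = *-congˡ 1ʳ
    ... | false | true  | true  = *-congˡ 1ʳ
    ... | false | false | true  = *-congˡ 1ʳ
    ... | true  | true  | false = *-congˡ 1ʳ
    ... | true  | false | false = *-congˡ 1ʳ
    ... | false | true  | false = *-congˡ 1ʳ
    ... | false | false | false = *-congˡ 1ʳ

  sum-if-last : ∀ k a b x → sum (λ (j : Fin (suc k)) → (if isLast j then a else b) * x) ≈ (a + nat· k b) * x
  sum-if-last k a b x =
    trans (sum-*ʳ (λ (j : Fin (suc k)) → if isLast j then a else b) x) (*-congʳ (sum-isLast k a b))

  -- For each `j` exactly one `l` closes a cycle, so the inner sum is `valleyW k` whichever one it
  -- is. The outer sum then contains only labelled choices.
  sum-valley : ∀ {k} (c : Fin (suc k) → Fin (suc k)) (f g : Fin (suc k) → Carrier) x →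
               sum (λ j → sum (λ l → f j * minW (does (l Fin.≟ c j)) * (g j * x)))
               ≈ sum (λ j → f j * g j) * (valleyW k * x)
  sum-valley {k} c f g x = begin
    sum (λ j → sum (λ l → f j * m j l * (g j * x)))
      ≈⟨ sum-cong-≋ (λ j → sum-cong-≋ λ l →
           solve 4 (λ f m g x → f :* m :* (g :* x) := m :* (f :* g :* x)) ≈-refl (f j) (m j l) (g j) x) ⟩
    sum (λ j → sum (λ l → m j l * (f j * g j * x)))
      ≈⟨ sum-cong-≋ (λ j → trans (sum-*ʳ (m j) (f j * g j * x)) (*-congʳ (sum-≟ (c j) ỹ₁ ṽ₁))) ⟩
    sum (λ j → valleyW k * (f j * g j * x))
      ≈⟨ sum-cong-≋ (λ j →
           solve 3 (λ v a x → v :* (a :* x) := a :* (v :* x)) ≈-refl (valleyW k) (f j * g j) x) ⟩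
    sum (λ j → f j * g j * (valleyW k * x))
      ≈⟨ sum-*ʳ (λ j → f j * g j) _ ⟩
    sum (λ j → f j * g j) * (valleyW k * x) ∎
    where
    m : Fin (suc k) → Fin (suc k) → Carrier
    m j l = minW (does (l Fin.≟ c j))

  H-suc-even : ∀ d k → isOddᵇ (suc d) ≡ false → H (suc d) k ≡ Hₑ d k
  H-suc-even d k o with isEvenᵇ (suc d) | odd≡not-even (suc d)
  ... | true  | _ = refl
  ... | false | e with () ← ≡.trans (≡.sym o) e

  H-suc-odd : ∀ d k → isOddᵇ (suc d) ≡ true → H (suc d) k ≡ Hₒ d k
  H-suc-odd d k o with isEvenᵇ (suc d) | odd≡not-even (suc d)
  ... | false | _ = refl
  ... | true  | e with () ← ≡.trans (≡.sym o) e

  even≡ : ∀ n {b} → isOddᵇ n ≡ b → isEvenᵇ n ≡ not b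
  even≡ n refl rewrite odd≡not-even n = ≡.sym (Bool.not-involutive _)

  -- Splitting a class by the role of the next element

  module _ {M : ℕ} where
    open State
    open Class
    open OpenList

    -- Both hooks are read off from the same permutation. This gives the disjointness of the classes
    -- of different moves.
    extends-unique : ∀ {i : Fin M} {k k₁ k₂ a b a′ b′} {S : State (suc (toℕ i)) k}
                     {S₁ : State (toℕ i) k₁} {S₂ : State (toℕ i) k₂} {v} →
                     Extends S S₁ i a b → Extends S S₂ i a′ b′ → Class S₁ v → Class S₂ v → a ≡ a′ × b ≡ b′
    extends-unique E₁ E₂ C₁ C₂ with _ , e₁ , e₂ ← restrictClass E₁ C₁ with _ , e₁′ , e₂′ ← restrictClass E₂ C₂ =
      ≡.trans e₁ (≡.sym e₁′) , ≡.trans e₂ (≡.sym e₂′)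

    module _ {i : Fin M} {g : Vec (Fin M) M → Carrier} where

      module _ {S : State {M} (suc (toℕ i)) 0} where

        even-step₀ : ∀ {x y} → isOddᵇ (val i) ≡ false →
                     SumOver (Class (fixState i refl S)) g x → SumOver (Class (peakState i refl S)) g y →
                     SumOver (Class S) g (x + y)
        even-step₀ o fix peak = sumOver-resp
          (λ { (inj₁ c) → proj₁ (restrictClass (fixExtends i refl S) c)
             ; (inj₂ c) → proj₁ (restrictClass (peakExtends i refl S) c) })
          from ≈-refl
          (sumOver-∪ fix peak λ c c′ →
            contradiction (proj₁ (extends-unique (fixExtends i refl S) (peakExtends i refl S) c c′)) λ ())
          where
          from : ∀ {v} → Class S v → Class (fixState i refl S) v ⊎ Class (peakState i refl S) v
          from C with even-hook C o
          ... | inj₁ h        = inj₁ (extendClass (fixExtends i refl S) C h)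
          ... | inj₂ (inj₁ h) = inj₂ (extendClass (peakExtends i refl S) C h)

        odd-step₀ : ∀ {x} → isOddᵇ (val i) ≡ true → SumOver (Class (fixState i refl S)) g x → SumOver (Class S) g x
        odd-step₀ o fix = sumOver-resp (proj₁ ∘ restrictClass (fixExtends i refl S)) from ≈-refl fix
          where
          from : ∀ {v} → Class S v → Class (fixState i refl S) v
          from C with odd-hook C o
          ... | inj₁ h = extendClass (fixExtends i refl S) C h
          ... | inj₂ (inj₁ (() , _))
          ... | inj₂ (inj₂ (() , _))

      module _ {k} {S : State {M} (suc (toℕ i)) (suc k)} where

        even-step : ∀ {x y} {z : Vector Carrier (suc k)} → isOddᵇ (val i) ≡ false →
                    SumOver (Class (fixState i refl S)) g x → SumOver (Class (peakState i refl S)) g y →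
                    (∀ j → SumOver (Class (dfallState i refl S j)) g (z j)) →
                    SumOver (Class S) g (x + (y + sum z))
        even-step {z = z} o fix peak dfall = sumOver-resp to from ≈-refl
          (sumOver-∪ fix (sumOver-∪ peak (sumOver-⋃ {x = z} dfall dfall!) peak≠) fix≠)
          where
          Q : Vec (Fin M) M → Set
          Q v = Class (fixState i refl S) v ⊎ Class (peakState i refl S) v ⊎ ∃ λ j → Class (dfallState i refl S j) v
          to : ∀ {v} → Q v → Class S v
          to (inj₁ c)              = proj₁ (restrictClass (fixExtends i refl S) c)
          to (inj₂ (inj₁ c))       = proj₁ (restrictClass (peakExtends i refl S) c)
          to (inj₂ (inj₂ (j , c))) = proj₁ (restrictClass (dfallExtends i refl S j) c)
          from : ∀ {v} → Class S v → Q v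
          from C with even-hook C o
          ... | inj₁ h              = inj₁ (extendClass (fixExtends i refl S) C h)
          ... | inj₂ (inj₁ h)       = inj₂ (inj₁ (extendClass (peakExtends i refl S) C h))
          ... | inj₂ (inj₂ (j , h)) = inj₂ (inj₂ (j , extendClass (dfallExtends i refl S j) C h))
          dfall! : ∀ {j j′ v} → Class (dfallState i refl S j) v → Class (dfallState i refl S j′) v → j ≡ j′
          dfall! c c′ with _ , e ← extends-unique (dfallExtends i refl S _) (dfallExtends i refl S _) c c′ =
            elem-injective (domOpen S) (just-injective e)
          peak≠ : ∀ {v} → Class (peakState i refl S) v → ¬ ∃ λ j → Class (dfallState i refl S j) v
          peak≠ c (j , c′) with () ← proj₂ (extends-unique (peakExtends i refl S) (dfallExtends i refl S j) c c′)
          fix≠ : ∀ {v} → Class (fixState i refl S) v →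
                 ¬ (Class (peakState i refl S) v ⊎ ∃ λ j → Class (dfallState i refl S j) v)
          fix≠ c (inj₁ c′) with () ← proj₁ (extends-unique (fixExtends i refl S) (peakExtends i refl S) c c′)
          fix≠ c (inj₂ (j , c′)) with () ← proj₁ (extends-unique (fixExtends i refl S) (dfallExtends i refl S j) c c′)

        odd-step : ∀ {x} {y : Vector Carrier (suc k)} {z : Fin (suc k) → Vector Carrier (suc k)} →
                   isOddᵇ (val i) ≡ true →
                   SumOver (Class (fixState i refl S)) g x →
                   (∀ l → SumOver (Class (driseState i refl S l)) g (y l)) →
                   (∀ j l → SumOver (Class (valleyState i refl S j l)) g (z j l)) →
                   SumOver (Class S) g (x + (sum y + sum (λ j → sum (z j))))
        odd-step {y = y} {z} o fix drise valley = sumOver-resp to from ≈-refl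
          (sumOver-∪ fix (sumOver-∪ (sumOver-⋃ {x = y} drise drise!)
            (sumOver-⋃ {x = λ j → sum (z j)} (λ j → sumOver-⋃ {x = z j} (valley j) valley!) valley!!) drise≠) fix≠)
          where
          Q₁ Q₂ Q : Vec (Fin M) M → Set
          Q₁ v = ∃ λ l → Class (driseState i refl S l) v
          Q₂ v = ∃ λ j → ∃ λ l → Class (valleyState i refl S j l) v
          Q v = Class (fixState i refl S) v ⊎ Q₁ v ⊎ Q₂ v
          to : ∀ {v} → Q v → Class S v
          to (inj₁ c)                  = proj₁ (restrictClass (fixExtends i refl S) c)
          to (inj₂ (inj₁ (l , c)))     = proj₁ (restrictClass (driseExtends i refl S l) c)
          to (inj₂ (inj₂ (j , l , c))) = proj₁ (restrictClass (valleyExtends i refl S j l) c)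
          from : ∀ {v} → Class S v → Q v
          from C with odd-hook C o
          ... | inj₁ h                  = inj₁ (extendClass (fixExtends i refl S) C h)
          ... | inj₂ (inj₁ (l , h))     = inj₂ (inj₁ (l , extendClass (driseExtends i refl S l) C h))
          ... | inj₂ (inj₂ (j , l , h)) = inj₂ (inj₂ (j , l , extendClass (valleyExtends i refl S j l) C h))
          drise! : ∀ {l l′ v} → Class (driseState i refl S l) v → Class (driseState i refl S l′) v → l ≡ l′
          drise! c c′ with e , _ ← extends-unique (driseExtends i refl S _) (driseExtends i refl S _) c c′ =
            elem-injective (ranOpen S) (just-injective e)
          valley! : ∀ {j l l′ v} → Class (valleyState i refl S j l) v → Class (valleyState i refl S j l′) v → l ≡ l′
          valley! c c′ with e , _ ← extends-unique (valleyExtends i refl S _ _) (valleyExtends i refl S _ _) c c′ =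
            elem-injective (ranOpen S) (just-injective e)
          valley!! : ∀ {j j′ v} → (∃ λ l → Class (valleyState i refl S j l) v) →
                     (∃ λ l → Class (valleyState i refl S j′ l) v) → j ≡ j′
          valley!! (_ , c) (_ , c′)
            with _ , e ← extends-unique (valleyExtends i refl S _ _) (valleyExtends i refl S _ _) c c′ =
            elem-injective (domOpen S) (just-injective e)
          drise≠ : ∀ {v} → Q₁ v → ¬ Q₂ v
          drise≠ (l , c) (j , l′ , c′)
            with () ← proj₂ (extends-unique (driseExtends i refl S l) (valleyExtends i refl S j l′) c c′)
          fix≠ : ∀ {v} → Class (fixState i refl S) v → ¬ (Q₁ v ⊎ Q₂ v)
          fix≠ c (inj₁ (l , c′)) with () ← proj₂ (extends-unique (fixExtends i refl S) (driseExtends i refl S l) c c′)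
          -- Both entries of the hook are `just` in either case, so the constructors do not separate
          -- them; the preimage does, being `i` on one side and an older point on the other.
          fix≠ c (inj₂ (j , l , c′)) = D-later i refl S j (just-injective
            (proj₂ (extends-unique (fixExtends i refl S) (valleyExtends i refl S j l) c c′)))

    -- The factor at `i` is constant on the class of a single move and comes out of the sum.
    scale : ∀ {i : Fin M} {Q : Vec (Fin M) M → Set} {f : Vec (Fin M) M → Fin M → Carrier} {a x} →
            (∀ {v} → Q v → f v i ≈ a) → SumOver Q (λ v → prodBelow (toℕ i) (f v)) x →
            SumOver Q (λ v → prodBelow (suc (toℕ i)) (f v)) (a * x)
    scale {i} {f = f} e = sumOver-scale λ {v} q → trans (prodBelow-suc (f v) i) (*-congʳ (e q))

    localW localW′ : Vec (Fin M) M → Fin M → Carrier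
    localW  v i = W (flagsAt (lookup v) i)
    localW′ v i = W′ (flagsAt (lookup v) i)

    module _ {i : Fin M} {k} {S : State {M} (suc (toℕ i)) k} where

      localW-peak : ∀ {v} → Class (peakState i refl S) v → localW v i ≈ 1#
      localW-peak {v} C′ =
        W-peak (flagsAt (lookup v) i) inv<≡ <inv≡ <im≡ fix≡ rec≡ pim<≡
        where
        Ch = restrictClass (peakExtends i refl S) C′
        C = proj₁ Ch
        h = proj₂ Ch
        open PeakFlags C h

      localW′-peak : ∀ {v} → Class (peakState i refl S) v → localW′ v i ≈ 1#
      localW′-peak {v} C′ =
        W′-peak (flagsAt (lookup v) i) <inv≡ fix≡ rec≡ qinv<≡
        where
        Ch = restrictClass (peakExtends i refl S) C′
        C = proj₁ Ch
        h = proj₂ Ch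
        open PeakFlags C h

    module _ {i : Fin M} {S : State {M} (suc (toℕ i)) 0} {b} (o : isOddᵇ (val i) ≡ b) where

      localW-fix₀ : ∀ {v} → Class (fixState i refl S) v → localW v i ≈ (if b then zₒ else zₑ)
      localW-fix₀ {v} C′ =
        W-fix-closed (flagsAt (lookup v) i) o (even≡ (val i) o) inv<≡ <inv≡ fix≡ (record-closed C σi≡i)
          (antirecord-closed C σi≡i) pim<≡
        where
        Ch = restrictClass (fixExtends i refl S) C′
        C = proj₁ Ch
        h = proj₂ Ch
        open FixFlags C h

      localW′-fix₀ : ∀ {v} → Class (fixState i refl S) v → localW′ v i ≈ (if b then zₒ else zₑ)
      localW′-fix₀ {v} C′ =
        W′-fix-closed (flagsAt (lookup v) i) o (even≡ (val i) o) <inv≡ fix≡ (record-closed C σi≡i)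
          (antirecord-closed C σi≡i) qinv<≡
        where
        Ch = restrictClass (fixExtends i refl S) C′
        C = proj₁ Ch
        h = proj₂ Ch
        open FixFlags C h

    module _ {i : Fin M} {k} {S : State {M} (suc (toℕ i)) (suc k)} where

      module _ {b} (o : isOddᵇ (val i) ≡ b) where

        localW-fix : ∀ {v} → Class (fixState i refl S) v → localW v i ≈ (if b then wₒ else wₑ)
        localW-fix {v} C′ =
          W-fix-open (flagsAt (lookup v) i) o (even≡ (val i) o) inv<≡ <inv≡ fix≡
            (record-false-open C zero (ℕ.≤-reflexive (≡.cong toℕ σi≡i)))
            (antirecord-false-open C zero (ℕ.≤-reflexive (≡.cong toℕ (≡.sym σi≡i)))) pim<≡
          where
          Ch = restrictClass (fixExtends i refl S) C′
          C = proj₁ Ch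
          h = proj₂ Ch
          open FixFlags C h

        localW′-fix : ∀ {v} → Class (fixState i refl S) v → localW′ v i ≈ (if b then wₒ else wₑ)
        localW′-fix {v} C′ =
          W′-fix-open (flagsAt (lookup v) i) o (even≡ (val i) o) <inv≡ fix≡
            (record-false-open C zero (ℕ.≤-reflexive (≡.cong toℕ σi≡i)))
            (antirecord-false-open C zero (ℕ.≤-reflexive (≡.cong toℕ (≡.sym σi≡i)))) qinv<≡
          where
          Ch = restrictClass (fixExtends i refl S) C′
          C = proj₁ Ch
          h = proj₂ Ch
          open FixFlags C h

      localW-dfall : ∀ {w} → DLabels S w → ∀ j {v} → Class (dfallState i refl S j) v →
                     localW v i ≈ pick (isLast j) (w j)
      localW-dfall lab j {v} C′ =
        W-dfall (flagsAt (lookup v) i) inv<≡ <im≡ <inv≡ fix≡ rec≡ pim<≡ pinv<≡ p<inv≡ prec≡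
          (≡.trans (≡.cong (Stats.antirecord? (lookup v)) p≡D) (antirecord-D C D→i))
        where
        Ch = restrictClass (dfallExtends i refl S j) C′
        C = proj₁ Ch
        h = proj₂ Ch
        open DFallFlags C h
        open Label lab

      localW′-dfall : ∀ j {v} → Class (dfallState i refl S j) v → localW′ v i ≈ (if isLast j then x₂ else u₂)
      localW′-dfall j {v} C′ =
        W′-dfall (flagsAt (lookup v) i) im<≡ <inv≡ <im≡ fix≡ rec≡ qinv<≡ prec≡
          (≡.trans (≡.cong (Stats.antirecord? (lookup v)) p≡D) (antirecord-D C D→i))
        where
        Ch = restrictClass (dfallExtends i refl S j) C′
        C = proj₁ Ch
        h = proj₂ Ch
        open DFallFlags C h

      localW-drise : ∀ l {v} → Class (driseState i refl S l) v → localW v i ≈ (if isLast l then y₂ else v₂)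
      localW-drise l {v} C′ =
        W-drise (flagsAt (lookup v) i) inv<≡ <inv≡ <im≡ fix≡ arec≡ (record-R C i→R) pim<≡
        where
        Ch = restrictClass (driseExtends i refl S l) C′
        C = proj₁ Ch
        h = proj₂ Ch
        open DRiseFlags C h

      localW′-drise : ∀ {w} → RLabels S w → ∀ l {v} → Class (driseState i refl S l) v →
                      localW′ v i ≈ pick′ (isLast l) (w l)
      localW′-drise lab l {v} C′ =
        W′-drise (flagsAt (lookup v) i) <inv≡ fix≡ arec≡ (record-R C i→R) qinv<≡ qim<≡ q<im≡
        where
        Ch = restrictClass (driseExtends i refl S l) C′
        C = proj₁ Ch
        h = proj₂ Ch
        open DRiseFlags C h
        open Label lab

      localW-valley : ∀ {w} → DLabels S w → ∀ j l {v} → Class (valleyState i refl S j l) v →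
                      localW v i ≈ pick (isLast j) (w j) * minW (does (l Fin.≟ proj₁ (startIndex S j)))
      localW-valley lab j l {v} C′ =
        W-valley (flagsAt (lookup v) i) inv<≡ <inv≡ <im≡ fix≡ arec≡ pim<≡ pinv<≡ p<inv≡ prec≡
          (≡.trans (≡.cong (Stats.antirecord? (lookup v)) p≡D) (antirecord-D C D→i)) (cycmin-start C D→i i→R)
        where
        Ch = restrictClass (valleyExtends i refl S j l) C′
        C = proj₁ Ch
        h = proj₂ Ch
        open FromD C h
        open Label lab
        open ToR C h using (<im≡; fix≡; arec≡; i→R)

      localW′-valley : ∀ {w} → RLabels S w → ∀ j l {v} → Class (valleyState i refl S j l) v →
                       localW′ v i ≈ pick′ (isLast l) (w l) * minW (does (j Fin.≟ proj₁ (endIndex S l)))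
      localW′-valley lab j l {v} C′ =
        W′-valley (flagsAt (lookup v) i) im<≡ <inv≡ <im≡ fix≡ arec≡ (record-R C i→R) qinv<≡ qim<≡ q<im≡
          (cycmin-end C D→i i→R)
        where
        Ch = restrictClass (valleyExtends i refl S j l) C′
        C = proj₁ Ch
        h = proj₂ Ch
        open ToR C h
        open Label lab
        open FromD C h using (<inv≡; D→i)

    -- Total weight of the extensions of a partial injection

    Claim Claim′ : ℕ → Set ℓ
    Claim  d = ∀ {k} (S : State {M} d k) → Parity S → ∀ w → DLabels S w →
               SumOver (Class S) (λ v → prodBelow d (localW v)) (Φ w * H d k)
    Claim′ d = ∀ {k} (S : State {M} d k) → Parity S → ∀ w → RLabels S w →
               SumOver (Class S) (λ v → prodBelow d (localW′ v)) (Φ′ w * H d k)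

    module _ (f : Vec (Fin M) M → Fin M → Carrier) where

      sumOver-full : (S : State {M} 0 0) → Parity S → SumOver (Class S) (λ v → prodBelow 0 (f v)) (1# * H 0 0)
      sumOver-full S P with v , C ← Class₀-inhabited S P = sumOver-resp (λ c → c) (λ c → c)
        (trans (prodBelow-zero (f v)) (sym (*-identityˡ _))) (sumOver-single C (λ C′ → Class₀-unique C′ C))

      sumOver-stuck : ∀ {k} (S : State {M} 0 (suc k)) x → SumOver (Class S) (λ v → prodBelow 0 (f v)) (x * H 0 (suc k))
      sumOver-stuck S x = sumOver-resp (λ c → c) (λ c → c) (sym (zeroʳ _)) (sumOver-empty Class₀-empty)

    resp : ∀ {Q : Vec (Fin M) M → Set} {g x y} → x ≈ y → SumOver Q g x → SumOver Q g y
    resp = sumOver-resp (λ c → c) (λ c → c)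

    claim-zero : Claim 0
    claim-zero {zero}  S P w lab = sumOver-full localW S P
    claim-zero {suc k} S P w lab = sumOver-stuck localW S (Φ w)

    claim′-zero : Claim′ 0
    claim′-zero {zero}  S P w lab = sumOver-full localW′ S P
    claim′-zero {suc k} S P w lab = sumOver-stuck localW′ S (Φ′ w)

    module _ (i : Fin M) where

      private d = toℕ i

      claim-even : isOddᵇ (val i) ≡ false → Claim d → Claim (suc d)
      claim-even o IH {zero} S P w lab = resp
        -- The product of `p` and `q` is `Φ` of the labels with the new peak added: it lies below
        -- all other open points, and its factor is `peakW` of their number. The factor `con 1` is
        -- the local weight of the peak.
        (trans (solve 5 (λ z p q h₀ h₁ → z :* (p :* h₀) :+ con 1 :* (p :* q :* h₁) := p :* (q :* h₁ :+ z :* h₀))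
                  ≈-refl zₑ (Φ w) (peakW 0) (H d 0) (H d 1))
               (*-congˡ (reflexive (≡.sym (H-suc-even d 0 o)))))
        (even-step₀ o (scale (localW-fix₀ o) (IH _ (parity-fix P) w (labels-fixᴰ lab)))
                      (scale localW-peak (IH _ (parity-peak P o) (false Vector.∷ w) (labels-peakᴰ lab))))
      claim-even o IH {suc k} S P w lab = resp
        (trans (+-congˡ (+-congˡ (sum-pick-* w r (H d (suc k)))))
        (trans (solve 6 (λ z p q r h₁ h₂ → z :* (p :* h₁) :+ (con 1 :* (p :* q :* h₂) :+ p :* (r :* h₁))
                                       := p :* (q :* h₂ :+ (r :+ z) :* h₁))
                  ≈-refl wₑ (Φ w) (peakW (suc k)) r (H d (suc k)) (H d (suc (suc k))))
               (*-congˡ (reflexive (≡.sym (H-suc-even d (suc k) o))))))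
        (even-step {z = z} o (scale (localW-fix o) (IH _ (parity-fix P) w (labels-fixᴰ lab)))
                     (scale localW-peak (IH _ (parity-peak P o) (false Vector.∷ w) (labels-peakᴰ lab)))
                     λ j → scale (localW-dfall lab j) (IH _ (parity-dfall P o j) _ (labels-dfallᴰ lab j)))
        where
        -- The factor in `Φ` of the new double fall `i`, which lies below the `k` open positions
        -- left after `j` is taken.
        r = x₂ + nat· k u₂
        z : Fin (suc k) → Carrier
        z j = pick (isLast j) (w j) * (Φ (w ∘ punchIn j) * r * H d (suc k))

      claim-odd : isOddᵇ (val i) ≡ true → Claim d → Claim (suc d)
      claim-odd o IH {zero} S P w lab = resp
        (trans (solve 3 (λ z p h → z :* (p :* h) := p :* (z :* h)) ≈-refl zₒ (Φ w) (H d 0))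
               (*-congˡ (reflexive (≡.sym (H-suc-odd d 0 o)))))
        (odd-step₀ o (scale (localW-fix₀ o) (IH _ (parity-fix P) w (labels-fixᴰ lab))))
      claim-odd o IH {suc k} S P w lab = resp
        (trans (+-congˡ (+-cong
           (sum-if-last k y₂ v₂ (Φ w * H d (suc k)))
           -- The labels sit on positions, so for fixed `j` the value `l` is summed first.
           (trans (sum-valley (proj₁ ∘ startIndex S) (λ j → pick (isLast j) (w j)) (λ j → Φ (w ∘ punchIn j)) (H d k))
                  (*-congʳ (sum-pick w)))))
        (trans (solve 6 (λ z p y v h₀ h₁ → z :* (p :* h₁) :+ (y :* (p :* h₁) :+ p :* (v :* h₀))
                                       := p :* (v :* h₀ :+ (y :+ z) :* h₁))
                  ≈-refl wₒ (Φ w) (y₂ + nat· k v₂) (valleyW k) (H d k) (H d (suc k)))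
               (*-congˡ (reflexive (≡.sym (H-suc-odd d (suc k) o))))))
        (odd-step {y = λ l → (if isLast l then y₂ else v₂) * (Φ w * H d (suc k))} {z = z} o
                  (scale (localW-fix o) (IH _ (parity-fix P) w (labels-fixᴰ lab)))
                  (λ l → scale (localW-drise l) (IH _ (parity-drise P o l) w (labels-driseᴰ lab l)))
                  (λ j l → scale (localW-valley lab j l) (IH _ (parity-valley P o j l) _ (labels-valleyᴰ lab j l))))
        where
        z : Fin (suc k) → Fin (suc k) → Carrier
        z j l = pick (isLast j) (w j) * minW (does (l Fin.≟ proj₁ (startIndex S j))) * (Φ (w ∘ punchIn j) * H d k)

      claim-suc : Claim d → Claim (suc d)
      claim-suc = by-parity (isOddᵇ (val i)) refl
        where
        by-parity : ∀ b → isOddᵇ (val i) ≡ b → Claim d → Claim (suc d)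
        by-parity true  = claim-odd
        by-parity false = claim-even

      -- Labels now sit on values, which a double fall leaves as they are. The term `x₂ + k u₂`
      -- comes from summing over the choices and not from the label of the new point; for double
      -- rises the exchange is the opposite one. Hence the same coefficients of `H` arise.
      claim′-even : isOddᵇ (val i) ≡ false → Claim′ d → Claim′ (suc d)
      claim′-even o IH {zero} S P w lab = resp
        (trans (solve 5 (λ z p q h₀ h₁ → z :* (p :* h₀) :+ con 1 :* (p :* q :* h₁) := p :* (q :* h₁ :+ z :* h₀))
                  ≈-refl zₑ (Φ′ w) (peakW 0) (H d 0) (H d 1))
               (*-congˡ (reflexive (≡.sym (H-suc-even d 0 o)))))
        (even-step₀ o (scale (localW′-fix₀ o) (IH _ (parity-fix P) w (labels-fixᴿ lab)))
                      (scale localW′-peak (IH _ (parity-peak P o) (false Vector.∷ w) (labels-peakᴿ lab))))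
      claim′-even o IH {suc k} S P w lab = resp
        (trans (+-congˡ (+-congˡ (sum-if-last k x₂ u₂ (Φ′ w * H d (suc k)))))
        (trans (solve 6 (λ z p q r h₁ h₂ → z :* (p :* h₁) :+ (con 1 :* (p :* q :* h₂) :+ r :* (p :* h₁))
                                       := p :* (q :* h₂ :+ (r :+ z) :* h₁))
                  ≈-refl wₑ (Φ′ w) (peakW (suc k)) (x₂ + nat· k u₂) (H d (suc k)) (H d (suc (suc k))))
               (*-congˡ (reflexive (≡.sym (H-suc-even d (suc k) o))))))
        (even-step {z = λ j → (if isLast j then x₂ else u₂) * (Φ′ w * H d (suc k))} o
                     (scale (localW′-fix o) (IH _ (parity-fix P) w (labels-fixᴿ lab)))
                     (scale localW′-peak (IH _ (parity-peak P o) (false Vector.∷ w) (labels-peakᴿ lab)))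
                     λ j → scale (localW′-dfall j) (IH _ (parity-dfall P o j) w (labels-dfallᴿ lab j)))

      claim′-odd : isOddᵇ (val i) ≡ true → Claim′ d → Claim′ (suc d)
      claim′-odd o IH {zero} S P w lab = resp
        (trans (solve 3 (λ z p h → z :* (p :* h) := p :* (z :* h)) ≈-refl zₒ (Φ′ w) (H d 0))
               (*-congˡ (reflexive (≡.sym (H-suc-odd d 0 o)))))
        (odd-step₀ o (scale (localW′-fix₀ o) (IH _ (parity-fix P) w (labels-fixᴿ lab))))
      claim′-odd o IH {suc k} S P w lab = resp
        (trans (+-congˡ (+-cong
           (sum-pick-*′ w r (H d (suc k)))
           -- The labelled index is now the value `l`, so the position `j` has to become the inner
           -- index.
           (trans (∑-comm z)
             (trans (sum-valley (proj₁ ∘ endIndex S) (λ l → pick′ (isLast l) (w l)) (λ l → Φ′ (w ∘ punchIn l)) (H d k))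
                    (*-congʳ (sum-pick′ w))))))
        (trans (solve 6 (λ z p y v h₀ h₁ → z :* (p :* h₁) :+ (p :* (y :* h₁) :+ p :* (v :* h₀))
                                       := p :* (v :* h₀ :+ (y :+ z) :* h₁))
                  ≈-refl wₒ (Φ′ w) r (valleyW k) (H d k) (H d (suc k)))
               (*-congˡ (reflexive (≡.sym (H-suc-odd d (suc k) o))))))
        (odd-step {y = y} {z = z} o
                  (scale (localW′-fix o) (IH _ (parity-fix P) w (labels-fixᴿ lab)))
                  (λ l → scale (localW′-drise lab l) (IH _ (parity-drise P o l) _ (labels-driseᴿ lab l)))
                  (λ j l → scale (localW′-valley lab j l) (IH _ (parity-valley P o j l) _ (labels-valleyᴿ lab j l))))
        where
        r = y₂ + nat· k v₂
        y : Fin (suc k) → Carrier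
        y l = pick′ (isLast l) (w l) * (Φ′ (w ∘ punchIn l) * r * H d (suc k))
        z : Fin (suc k) → Fin (suc k) → Carrier
        z j l = pick′ (isLast l) (w l) * minW (does (j Fin.≟ proj₁ (endIndex S l))) * (Φ′ (w ∘ punchIn l) * H d k)

      claim′-suc : Claim′ d → Claim′ (suc d)
      claim′-suc = by-parity (isOddᵇ (val i)) refl
        where
        by-parity : ∀ b → isOddᵇ (val i) ≡ b → Claim′ d → Claim′ (suc d)
        by-parity true  = claim′-odd
        by-parity false = claim′-even

    -- The step takes an element and not a number, because the moves are formed at threshold `toℕ i`
    -- with `refl` as the proof of `toℕ i ≡ d`.
    below-induction : (C : ℕ → Set ℓ) → C 0 → (∀ (i : Fin M) → C (toℕ i) → C (suc (toℕ i))) →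
                      ∀ d → d ℕ.≤ M → C d
    below-induction C c₀ step zero    _   = c₀
    below-induction C c₀ step (suc d) d<M = ≡.subst (C ∘ suc) (Fin.toℕ-fromℕ< d<M)
      (step (Fin.fromℕ< d<M) (≡.subst C (≡.sym (Fin.toℕ-fromℕ< d<M)) (below-induction C c₀ step d (ℕ.<⇒≤ d<M))))

    claim : Claim M
    claim = below-induction Claim claim-zero claim-suc M ℕ.≤-refl

    claim′ : Claim′ M
    claim′ = below-induction Claim′ claim′-zero claim′-suc M ℕ.≤-refl

    -- From the empty partial injection to `P` and `P′`

    parity-empty : Parity (empty {M})
    parity-empty = record
      { odd-out = λ {p} M≤p → contradiction (Fin.toℕ<n p) (ℕ.≤⇒≯ M≤p) ; even-out = λ _ () }

    -- At threshold `M` the empty state imposes nothing, so its class consists of all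
    -- D-permutations.
    sumOver-DPerm : (f : Vec (Fin M) M → Fin M → Carrier) (g : (Fin M → Fin M) → Carrier) →
                    (∀ {v} → DPerm (lookup v) → g (lookup v) ≈ prodBelow M (f v)) →
                    SumOver (Class empty) (λ v → prodBelow M (f v)) (1# * H M 0) →
                    SumOver (DPerm ∘ lookup) (g ∘ lookup) (H M 0)
    sumOver-DPerm f g e s = sumOver-resp dperm all (trans (*-identityˡ _) (*-identityˡ _))
      (sumOver-scale (λ C → trans (e (dperm C)) (sym (*-identityˡ _))) s)
      where
      all : ∀ {v} → DPerm (lookup v) → Class empty v
      all dp = record
        { dperm = dp
        ; out-agrees = λ {p} M≤p → contradiction (Fin.toℕ<n p) (ℕ.≤⇒≯ M≤p)
        ; inn-agrees = λ {p} M≤p → contradiction (Fin.toℕ<n p) (ℕ.≤⇒≯ M≤p)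
        }

  -- The filter on functions is pulled back through `lookup` to one on vectors, where the
  -- enumeration is known to be complete and free of duplicates.
  sumR-DPerms : ∀ n (g : (Fin (2 ℕ.* n) → Fin (2 ℕ.* n)) → Carrier) {x} →
                SumOver (DPerm ∘ lookup) (g ∘ lookup) x → sumR (map g (DPerms n)) ≈ x
  sumR-DPerms n g s = trans (reflexive (≡.cong sumR (≡.trans
      (≡.cong (map g) (filterᵇ-map lookup isDPermᵇ (allVecs (2 ℕ.* n)))) (≡.sym (map-∘ _)))))
    (sumOver-list s (filter⁺ D? (allVecs-unique (2 ℕ.* n)))
      (isDPermᵇ⇒DPerm ∘ T⇒≡ ∘ proj₂ ∘ ∈-filter⁻ D? {xs = allVecs (2 ℕ.* n)})
      (∈-filter⁺ D? (allVecs-complete _) ∘ ≡⇒T ∘ DPerm⇒isDPermᵇ))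
    where D? = λ v → T? (isDPermᵇ (lookup v))

  P≈H : ∀ n → P n ≈ H (2 ℕ.* n) 0
  P≈H n = sumR-DPerms n weight (sumOver-DPerm localW weight
    (λ {v} dp → trans (weight≈prod (lookup v) (DPerm.injective dp)) (sym (prodBelow-all (localW v))))
    (claim empty parity-empty (λ ()) (λ _ ())))

  P′≈H : ∀ n → P′ n ≈ H (2 ℕ.* n) 0
  P′≈H n = sumR-DPerms n weight′ (sumOver-DPerm localW′ weight′
    (λ {v} dp → trans (weight′≈prod (lookup v) (DPerm.injective dp)) (sym (prodBelow-all (localW′ v))))
    (claim′ empty parity-empty (λ ()) (λ _ ())))

theorem4p5 : ∀ {c ℓ} (R : CommutativeRing c ℓ)
    (x₁ x₂ ỹ₁ y₂ u₁ u₂ ṽ₁ v₂ wₑ wₒ zₑ zₒ : CommutativeRing.Carrier R) →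
    let open CommutativeRing R
        open Poly R x₁ x₂ ỹ₁ y₂ u₁ u₂ ṽ₁ v₂ wₑ wₒ zₑ zₒ
    in ((n : ℕ) → TFracCoeff n (P′ n)) × ((n : ℕ) → P′ n ≈ P n)
theorem4p5 R x₁ x₂ ỹ₁ y₂ u₁ u₂ ṽ₁ v₂ wₑ wₒ zₑ zₒ =
  (λ n → proj₁ (H-TFraction n) , λ N N₀≤N → trans (proj₂ (H-TFraction n) N N₀≤N) (sym (P′≈H n))) ,
  (λ n → trans (P′≈H n) (sym (P≈H n)))
  where
  open CommutativeRing R
  open Evaluation R x₁ x₂ ỹ₁ y₂ u₁ u₂ ṽ₁ v₂ wₑ wₒ zₑ zₒ
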